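{- Let $(G,X,H,f)$ be a constructible configuration. Then the following statements hold: (a) $\sum_{x\in X_v}f(x)=d_G(v)$ for all $v\in V(G)$. (b) $(G,X,H,f)$ is uncolorable.
   Context: $\mathbb{N}=\{1,2,\dots\}$, $\mathbb{N}_0=\mathbb{N}\cup\{0\}$. Graphs are finite, undirected, may have multiple edges, no loops; connected graphs are non-empty. $\mu_G(u,v)$ is the number of edges joining $u,v$; $d_G(v)$ is the number of edges incident with $v$. $tG$ has vertex set $V(G)$ and $\mu_{tG}=t\mu_G$. $K_n$, $C_n$ ($n\ge3$), $K_{s,s}$ are the simple complete graph, cycle, complete bipartite graph. A graph is a block if it is connected, non-empty and has no vertex whose deletion leaves at least two components. Covers. A cover of $G$ is a pair $(X,H)$, $H$ a graph, $X$ assigning to each $v\in V(G)$ a set $X_v\subseteq V(H)$, such that the $X_v$ are pairwise disjoint with union $V(H)$, each $X_v$ is independent in $H$, and for distinct $u,v\in V(G)$ the set of edges of $H$ between $X_u$ and $X_v$ is the union of $\mu_G(u,v)$ (possibly empty) matchings. A transversal is a set $T\subseteq V(H)$ with $|T\cap X_v|=1$ for all $v$. For $U\subseteq V(H)$ put $X_v(U)=X_v\cap U$; $(X,H)/U$ is the cover $(X',H[U])$ of $G[\{v: X_v(U)\ne\varnothing\}]$ with $X'_v=X_v(U)$. Configurations. A configuration is a tuple $(G,X,H,f)$ with $(X,H)$ a cover of the graph $G$ and $f:V(H)\to\mathbb{N}_0$. It is uniform if for some $r\ge1$ all $|X_v|=r$. A subgraph $\tilde H$ of $H$ is strictly $f$-degenerate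 if each non-empty subgraph $H'$ of $\tilde H$ has a vertex $x$ with $d_{H'}(x)<f(x)$. The configuration is colorable if $(X,H)$ has a transversal $T$ with $H[T]$ strictly $f$-degenerate, otherwise uncolorable. Special covers (all up to renaming vertices of the cover graph). A $G$-cover is a cover with $X_v=\{x_v\}$ for all $v$ and $\mu_H(x_u,x_v)=\mu_G(u,v)$ for all distinct $u,v$. For $G=tC_n$ with $C_n=(v_1,\dots,v_n,v_1)$, a double $G$-cover is a cover with $X_{v_i}=\{x_i,x_{n+i}\}$ ($1\le i\le n$), $\mu_H(x_i,x_j)=t$ if $i-j\equiv\pm1 \pmod{2n}$ and $\mu_H(x_i,x_j)=0$ otherwise. If $s\in\mathbb{N}$ divides all multiplicities $\mu_H(x,y)$, the $s$-inflation of $(X,H)$ is the cover $(\tilde X,\tilde H)$ of $G$ obtained by replacing every $x\in V(H)$ by a set $U_x$ of $s$ new vertices, with $\tilde X_v=\bigcup_{x\in X_v}U_x$, and for distinct $x,y\in V(H)$ placing a copy of $mK_{s,s}$ with parts $U_x,U_y$, where $m=\mu_H(x,y)/s$. An inflation is an $s$-inflation for some $s\in\mathbb{N}$. Constructible configurations. The family of constructible configurations is defined recursively: a uniform configuration $(G,X,H,f)$ is constructible if one of the following holds. (K1) M-configuration: $G$ is a block and there is $U\subseteq V(H)$ such that $(X,H)/U$ is an inflation of a $G$-cover, and for $v\in V(G)$, $x\in X_v$: $f(x)=d_G(v)/|X_v(U)|$ if $x\in U$, else $f(x)=0$. (K2) K-configuration: $G=tK_n$ with $t,n\in\mathbb{N}$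 and there are $p\ge1$, $n_1,\dots,n_p\in\mathbb{N}$ with $n_1+\dots+n_p=n-1$ and pairwise disjoint $U_1,\dots,U_p\subseteq V(H)$ such that each $(X,H)/U_i$ is an inflation of a $G$-cover, and for $v\in V(G)$, $x\in X_v$: $f(x)=tn_i/|X_v(U_i)|$ if $x\in U_i$ for some $i$, else $f(x)=0$. (K3) Odd C-configuration: $G=tC_n$ with $t\in\mathbb{N}$, $n\ge3$ odd, and there are disjoint $U_1,U_2\subseteq V(H)$ such that each $(X,H)/U_i$ is an inflation of a $G$-cover, and for $v\in V(G)$, $x\in X_v$: $f(x)=t/|X_v(U_i)|$ if $x\in U_i$ for $i\in\{1,2\}$, else $f(x)=0$. (K4) Even C-configuration: $G=tC_n$ with $t\in\mathbb{N}$, $n\ge4$ even, and there is $U\subseteq V(H)$ such that $(X,H)/U$ is an inflation of a double $G$-cover, and for $v\in V(G)$, $x\in X_v$: $f(x)=2t/|X_v(U)|$ if $x\in U$, else $f(x)=0$. (K5) There are two disjoint constructible configurations $(G^1,X^1,H^1,f^1)$, $(G^2,X^2,H^2,f^2)$ such that $G$ is obtained from the disjoint graphs $G^1,G^2$ by identifying a vertex $v^1\in V(G^1)$ and a vertex $v^2\in V(G^2)$ to a new vertex $v^*$; $H$ is obtained from the disjoint graphs $H^1,H^2$ by choosing a bijection $\pi:X^1_{v^1}\to X^2_{v^2}$ and identifying each $x\in X^1_{v^1}$ with $\pi(x)$ to a vertex $x^*$ (so $X_{v^*}$ is the set of these $x^*$, and $X_v=X^i_v$ for other $v\in V(G^i)$);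 and $f(y)=f^i(y)$ for $y\in V(H^i)\setminus X^i_{v^i}$, $f(x^*)=f^1(x)+f^2(\pi(x))$ for $x\in X^1_{v^1}$. -}

module Defs where

open import Algebra.Properties.CommutativeMonoid.Sum using () renaming (sum to sumOf)
open import Data.Bool using (Bool; true; false; T; _∧_; if_then_else_)
open import Data.Bool.Properties using (∧-comm)
open import Data.Fin using (Fin; toℕ; _↑ˡ_; _↑ʳ_)
open import Data.Fin.Properties using (nonZeroIndex)
open import Data.Fin.Subset using (Subset; _∈_; _∉_; _⊆_; _∩_; _∪_; ∁; ⁅_⁆; ∣_∣; Nonempty; Empty)
open import Data.Fin.Subset.Properties using (x∈p∩q⁺)
open import Data.Nat using (ℕ; suc; _+_; _*_; _∸_; _≤_; _<_; _%_)
open import Data.Nat.Divisibility using (_∣_; _∤_)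
open import Data.Nat.Properties using (+-0-commutativeMonoid)
open import Data.Product using (∃; ∃-syntax; _×_; _,_)
open import Data.Sum using (_⊎_)
open import Data.Vec using (lookup)
open import Data.Vec.Properties using (lookup⇒[]=)
open import Function.Bundles using (_⇔_)
open import Function.Definitions using (Injective)
open import Relation.Binary.Construct.Closure.ReflexiveTransitive using (Star)
open import Relation.Binary.PropositionalEquality using (_≡_; _≢_; refl)
open import Relation.Nullary using (¬_; contradiction)

sum : ∀ {n} → (Fin n → ℕ) → ℕ
sum = sumOf +-0-commutativeMonoid

sumOver : ∀ {n} → Subset n → (Fin n → ℕ) → ℕ
sumOver S f = sum λ x → if lookup S x then f x else 0

-- A finite loopless multigraph is given by its vertex set, a subset of some
-- label set Fin n, and its multiplicity function.  Labels outside V are not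
-- vertices and carry no edges, so sums of multiplicities may range over Fin n.

record Graph (n : ℕ) : Set where
  field
    V         : Subset n
    μ         : Fin n → Fin n → ℕ
    symmetric : ∀ u v → μ u v ≡ μ v u
    loopless  : ∀ v → μ v v ≡ 0
    supported : ∀ u v → μ u v ≢ 0 → u ∈ V

open Graph public

deg : ∀ {n} → Graph n → Fin n → ℕ
deg G v = sum (μ G v)

record _⊑_ {n} (G′ G : Graph n) : Set where
  field
    V-⊆ : V G′ ⊆ V G
    μ-≤ : ∀ u v → μ G′ u v ≤ μ G u v

induced : ∀ {n} → Graph n → Subset n → Graph n
induced {n} G W = record
  { V = V G ∩ W ; μ = μ′ ; symmetric = sym′ ; loopless = loopless′ ; supported = supported′ }
  where
  μ′ : Fin n → Fin n → ℕ
  μ′ u v = if lookup W u ∧ lookup W v then μ G u v else 0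

  sym′ : ∀ u v → μ′ u v ≡ μ′ v u
  sym′ u v rewrite ∧-comm (lookup W u) (lookup W v) | symmetric G u v = refl

  loopless′ : ∀ v → μ′ v v ≡ 0
  loopless′ v with lookup W v ∧ lookup W v
  ... | true  = loopless G v
  ... | false = refl

  supported′ : ∀ u v → μ′ u v ≢ 0 → u ∈ V G ∩ W
  supported′ u v μ′≢0 with lookup W u in eq | lookup W v
  ... | true  | true  = x∈p∩q⁺ (supported G u v μ′≢0 , lookup⇒[]= u W eq)
  ... | true  | false = contradiction refl μ′≢0
  ... | false | _     = contradiction refl μ′≢0

Reachable : ∀ {n} → Graph n → Fin n → Fin n → Set
Reachable G = Star λ u v → 0 < μ G u v

Connected : ∀ {n} → Graph n → Set
Connected G = Nonempty (V G) × (∀ {u v} → u ∈ V G → v ∈ V G → Reachable G u v)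

AtLeastTwoComponents : ∀ {n} → Graph n → Set
AtLeastTwoComponents G = ∃[ u ] ∃[ v ] u ∈ V G × v ∈ V G × ¬ Reachable G u v

Block : ∀ {n} → Graph n → Set
Block G = Connected G × (∀ {v} → v ∈ V G → ¬ AtLeastTwoComponents (induced G (∁ ⁅ v ⁆)))

-- G = tKₙ
record IsMultiComplete (t n : ℕ) {k} (G : Graph k) : Set where
  field
    order : ∣ V G ∣ ≡ n
    mult  : ∀ {u v} → u ∈ V G → v ∈ V G → u ≢ v → μ G u v ≡ t

-- i - j ≡ ±1 (mod n)
CyclicallyAdjacent : ∀ {n} → Fin n → Fin n → Set
CyclicallyAdjacent i j = Next i j ⊎ Next j i
  where
  Next : ∀ {n} → Fin n → Fin n → Set
  Next {n} i j = _%_ (suc (toℕ i)) n {{nonZeroIndex i}} ≡ toℕ j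

-- G = tCₙ with Cₙ = (c 0 , … , c (n - 1) , c 0)
record IsMultiCycle (t n : ℕ) {k} (G : Graph k) (c : Fin n → Fin k) : Set where
  field
    injective   : Injective _≡_ _≡_ c
    vertices    : ∀ v → v ∈ V G ⇔ (∃[ i ] c i ≡ v)
    adjacent    : ∀ i j → CyclicallyAdjacent i j → μ G (c i) (c j) ≡ t
    nonadjacent : ∀ i j → ¬ CyclicallyAdjacent i j → μ G (c i) (c j) ≡ 0

-- The lists X v matter only for v ∈ V G, where G is the covered graph.
record CoverData (n m : ℕ) : Set where
  constructor _,,_
  field
    X : Fin n → Subset m
    H : Graph m

open CoverData public

-- The edges of H between disjoint sets A and B, parallel edges being told
-- apart by a label.
record EdgeBetween {m} (H : Graph m) (A B : Subset m) : Set where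
  field
    {x y} : Fin m
    .x∈A  : x ∈ A
    .y∈B  : y ∈ B
    label : Fin (μ H x y)

IsMatching : ∀ {m} {H : Graph m} {A B} → (EdgeBetween H A B → Bool) → Set
IsMatching M = ∀ e e′ → T (M e) → T (M e′) → x e ≡ x e′ ⊎ y e ≡ y e′ → e ≡ e′
  where open EdgeBetween

IsUnionOfMatchings : ∀ {m} → Graph m → Subset m → Subset m → ℕ → Set
IsUnionOfMatchings H A B k =
  ∃ λ (M : Fin k → EdgeBetween H A B → Bool) →
    (∀ i → IsMatching (M i)) × (∀ e → ∃[ i ] T (M i e))

record IsCover {n m} (G : Graph n) (C : CoverData n m) : Set where
  field
    disjoint    : ∀ {u v} → u ∈ V G → v ∈ V G → u ≢ v → Empty (X C u ∩ X C v)
    union       : ∀ x → x ∈ V (H C) ⇔ (∃[ v ] v ∈ V G × x ∈ X C v)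
    independent : ∀ {v x y} → v ∈ V G → x ∈ X C v → y ∈ X C v → μ (H C) x y ≡ 0
    matchings   : ∀ {u v} → u ∈ V G → v ∈ V G → u ≢ v →
                  IsUnionOfMatchings (H C) (X C u) (X C v) (μ G u v)

IsTransversal : ∀ {n m} → Graph n → CoverData n m → Subset m → Set
IsTransversal G C T = T ⊆ V (H C) × (∀ {v} → v ∈ V G → ∣ T ∩ X C v ∣ ≡ 1)

-- (X , H) / U.  The graph it covers, G[{v : X v ∩ U ≠ ∅}], is not part of the
-- data; it is G whenever C / U is an inflation of a G-cover or of a double
-- G-cover, as all X v ∩ U with v ∈ V G are then non-empty.
_/_ : ∀ {n m} → CoverData n m → Subset m → CoverData n m
C / U = (λ v → X C v ∩ U) ,, induced (H C) U

record IsGCover {n m} (G : Graph n) (C : CoverData n m) : Set where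
  field
    isCover   : IsCover G C
    x         : Fin n → Fin m
    singleton : ∀ {v} → v ∈ V G → X C v ≡ ⁅ x v ⁆
    mult      : ∀ {u v} → u ∈ V G → v ∈ V G → u ≢ v → μ (H C) (x u) (x v) ≡ μ G u v

-- G = tCₙ with cyclic vertex enumeration c.
record IsDoubleCover (t n : ℕ) {k m} (G : Graph k) (c : Fin n → Fin k)
                     (C : CoverData k m) : Set where
  field
    isCover     : IsCover G C
    x           : Fin (n + n) → Fin m
    injective   : Injective _≡_ _≡_ x
    pair        : ∀ i → X C (c i) ≡ ⁅ x (i ↑ˡ n) ⁆ ∪ ⁅ x (n ↑ʳ i) ⁆
    adjacent    : ∀ i j → CyclicallyAdjacent i j → μ (H C) (x i) (x j) ≡ t
    nonadjacent : ∀ i j → ¬ CyclicallyAdjacent i j → μ (H C) (x i) (x j) ≡ 0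

-- C̃ is the s-inflation of the cover C of G, up to renaming; B x is the set of
-- vertices replacing x.
record IsInflation (s : ℕ) {n m m̃} (G : Graph n)
                   (C : CoverData n m) (C̃ : CoverData n m̃) : Set where
  field
    s≥1         : 1 ≤ s
    divides     : ∀ x y → s ∣ μ (H C) x y
    B           : Fin m → Subset m̃
    size        : ∀ {x} → x ∈ V (H C) → ∣ B x ∣ ≡ s
    disjoint    : ∀ {x y} → x ∈ V (H C) → y ∈ V (H C) → x ≢ y → Empty (B x ∩ B y)
    vertices    : ∀ a → a ∈ V (H C̃) ⇔ (∃[ x ] x ∈ V (H C) × a ∈ B x)
    lists       : ∀ {v} → v ∈ V G → ∀ a → a ∈ X C̃ v ⇔ (∃[ x ] x ∈ X C v × a ∈ B x)
    between     : ∀ {x y a b} → x ∈ V (H C) → y ∈ V (H C) → x ≢ y → a ∈ B x → b ∈ B y →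
                  μ (H C̃) a b * s ≡ μ (H C) x y
    independent : ∀ {x a b} → x ∈ V (H C) → a ∈ B x → b ∈ B x → μ (H C̃) a b ≡ 0

IsInflationOfGCover : ∀ {n m} → Graph n → CoverData n m → Set
IsInflationOfGCover {n} G C̃ =
  ∃[ s ] ∃[ m ] ∃ λ (C : CoverData n m) → IsGCover G C × IsInflation s G C C̃

IsInflationOfDoubleCover : (t n : ℕ) → ∀ {k m} (G : Graph k) → (Fin n → Fin k) → CoverData k m → Set
IsInflationOfDoubleCover t n {k} G c C̃ =
  ∃[ s ] ∃[ m ] ∃ λ (C : CoverData k m) → IsDoubleCover t n G c C × IsInflation s G C C̃

record Configuration : Set where
  field
    {n m}   : ℕ
    graph   : Graph n
    cover   : CoverData n m
    isCover : IsCover graph cover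
    f       : Fin m → ℕ

  list : Fin n → Subset m
  list = X cover

  coverGraph : Graph m
  coverGraph = H cover

IsUniform : Configuration → Set
IsUniform 𝒞 = ∃[ r ] 1 ≤ r × (∀ {v} → v ∈ V graph → ∣ list v ∣ ≡ r)
  where open Configuration 𝒞

StrictlyDegenerate : ∀ {m} → (Fin m → ℕ) → Graph m → Set
StrictlyDegenerate f H̃ =
  ∀ H′ → H′ ⊑ H̃ → Nonempty (V H′) → ∃[ x ] x ∈ V H′ × deg H′ x < f x

Colorable : Configuration → Set
Colorable 𝒞 = ∃[ T ] IsTransversal graph cover T × StrictlyDegenerate f (induced coverGraph T)
  where open Configuration 𝒞

Uncolorable : Configuration → Set
Uncolorable 𝒞 = ¬ Colorable 𝒞

-- The quotients a / b prescribed as values of f (with b ≥ 1) are expressed by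
-- f x * b ≡ a.

record IsMConfiguration (𝒞 : Configuration) : Set where
  open Configuration 𝒞
  field
    block     : Block graph
    U         : Subset m
    U⊆V       : U ⊆ V coverGraph
    inflation : IsInflationOfGCover graph (cover / U)
    f-inside  : ∀ {v x} → v ∈ V graph → x ∈ list v → x ∈ U →
                f x * ∣ list v ∩ U ∣ ≡ deg graph v
    f-outside : ∀ {v x} → v ∈ V graph → x ∈ list v → x ∉ U → f x ≡ 0

record IsKConfiguration (𝒞 : Configuration) : Set where
  open Configuration 𝒞
  field
    t k p     : ℕ
    t≥1       : 1 ≤ t
    k≥1       : 1 ≤ k
    p≥1       : 1 ≤ p
    complete  : IsMultiComplete t k graph
    ns        : Fin p → ℕ
    ns≥1      : ∀ i → 1 ≤ ns i
    sum-ns    : sum ns ≡ k ∸ 1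
    U         : Fin p → Subset m
    U⊆V       : ∀ i → U i ⊆ V coverGraph
    disjoint  : ∀ i j → i ≢ j → Empty (U i ∩ U j)
    inflation : ∀ i → IsInflationOfGCover graph (cover / U i)
    f-inside  : ∀ {v x} → v ∈ V graph → x ∈ list v → ∀ i → x ∈ U i →
                f x * ∣ list v ∩ U i ∣ ≡ t * ns i
    f-outside : ∀ {v x} → v ∈ V graph → x ∈ list v → (∀ i → x ∉ U i) → f x ≡ 0

record IsOddCConfiguration (𝒞 : Configuration) : Set where
  open Configuration 𝒞
  field
    t k        : ℕ
    t≥1        : 1 ≤ t
    k≥3        : 3 ≤ k
    odd        : 2 ∤ k
    c          : Fin k → Fin n
    cycle      : IsMultiCycle t k graph c
    U₁ U₂      : Subset m
    U₁⊆V       : U₁ ⊆ V coverGraph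
    U₂⊆V       : U₂ ⊆ V coverGraph
    disjoint   : Empty (U₁ ∩ U₂)
    inflation₁ : IsInflationOfGCover graph (cover / U₁)
    inflation₂ : IsInflationOfGCover graph (cover / U₂)
    f-inside₁  : ∀ {v x} → v ∈ V graph → x ∈ list v → x ∈ U₁ → f x * ∣ list v ∩ U₁ ∣ ≡ t
    f-inside₂  : ∀ {v x} → v ∈ V graph → x ∈ list v → x ∈ U₂ → f x * ∣ list v ∩ U₂ ∣ ≡ t
    f-outside  : ∀ {v x} → v ∈ V graph → x ∈ list v → x ∉ U₁ → x ∉ U₂ → f x ≡ 0

record IsEvenCConfiguration (𝒞 : Configuration) : Set where
  open Configuration 𝒞
  field
    t k       : ℕ
    t≥1       : 1 ≤ t
    k≥4       : 4 ≤ k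
    even      : 2 ∣ k
    c         : Fin k → Fin n
    cycle     : IsMultiCycle t k graph c
    U         : Subset m
    U⊆V       : U ⊆ V coverGraph
    inflation : IsInflationOfDoubleCover t k graph c (cover / U)
    f-inside  : ∀ {v x} → v ∈ V graph → x ∈ list v → x ∈ U →
                f x * ∣ list v ∩ U ∣ ≡ 2 * t
    f-outside : ∀ {v x} → v ∈ V graph → x ∈ list v → x ∉ U → f x ≡ 0

-- G is obtained, up to renaming, from disjoint copies of G¹ and G² by
-- identifying u ∈ V G¹ with w ∈ V G² whenever u ∼ w; ι¹ and ι² send the
-- vertices of G¹ and G² to those of G.  Here ∼ is a bijection between an
-- independent set of G¹ and one of G², so no edges of G¹ become parallel to
-- edges of G².
record IsIdentification {n¹ n² n} (G¹ : Graph n¹) (G² : Graph n²) (_∼_ : Fin n¹ → Fin n² → Set)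
                        (G : Graph n) (ι¹ : Fin n¹ → Fin n) (ι² : Fin n² → Fin n) : Set where
  field
    injective¹ : ∀ {u v} → u ∈ V G¹ → v ∈ V G¹ → ι¹ u ≡ ι¹ v → u ≡ v
    injective² : ∀ {u v} → u ∈ V G² → v ∈ V G² → ι² u ≡ ι² v → u ≡ v
    identified : ∀ {u w} → u ∈ V G¹ → w ∈ V G² → ι¹ u ≡ ι² w ⇔ u ∼ w
    vertices   : ∀ v → v ∈ V G ⇔ ((∃[ u ] u ∈ V G¹ × ι¹ u ≡ v) ⊎ (∃[ w ] w ∈ V G² × ι² w ≡ v))
    mult¹      : ∀ {u v} → u ∈ V G¹ → v ∈ V G¹ → μ G (ι¹ u) (ι¹ v) ≡ μ G¹ u v
    mult²      : ∀ {u v} → u ∈ V G² → v ∈ V G² → μ G (ι² u) (ι² v) ≡ μ G² u v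
    mult-cross : ∀ {u w} → u ∈ V G¹ → w ∈ V G² → (∀ w′ → ¬ u ∼ w′) → (∀ u′ → ¬ u′ ∼ w) →
                 μ G (ι¹ u) (ι² w) ≡ 0

record IsBijection {a b} (A : Subset a) (B : Subset b) (π : Fin a → Fin b) : Set where
  field
    maps-to    : ∀ {x} → x ∈ A → π x ∈ B
    injective  : ∀ {x y} → x ∈ A → y ∈ A → π x ≡ π y → x ≡ y
    surjective : ∀ {y} → y ∈ B → ∃[ x ] x ∈ A × π x ≡ y

record IsMerge (𝒞¹ 𝒞² 𝒞 : Configuration) : Set where
  open Configuration 𝒞
  private
    module C¹ = Configuration 𝒞¹
    module C² = Configuration 𝒞²
  field
    v¹        : Fin C¹.n
    v²        : Fin C².n
    v¹∈V      : v¹ ∈ V C¹.graph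
    v²∈V      : v² ∈ V C².graph
    ι¹        : Fin C¹.n → Fin n
    ι²        : Fin C².n → Fin n
    graph-id  : IsIdentification C¹.graph C².graph (λ u w → u ≡ v¹ × w ≡ v²) graph ι¹ ι²
    π         : Fin C¹.m → Fin C².m
    bijection : IsBijection (C¹.list v¹) (C².list v²) π
    κ¹        : Fin C¹.m → Fin m
    κ²        : Fin C².m → Fin m
    cover-id  : IsIdentification C¹.coverGraph C².coverGraph
                  (λ x y → x ∈ C¹.list v¹ × π x ≡ y) coverGraph κ¹ κ²
    lists¹    : ∀ {v} → v ∈ V C¹.graph → ∀ y → y ∈ list (ι¹ v) ⇔ (∃[ x ] x ∈ C¹.list v × κ¹ x ≡ y)
    lists²    : ∀ {v} → v ∈ V C².graph → ∀ y → y ∈ list (ι² v) ⇔ (∃[ x ] x ∈ C².list v × κ² x ≡ y)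
    f¹        : ∀ {y} → y ∈ V C¹.coverGraph → y ∉ C¹.list v¹ → f (κ¹ y) ≡ C¹.f y
    f²        : ∀ {y} → y ∈ V C².coverGraph → y ∉ C².list v² → f (κ² y) ≡ C².f y
    f*        : ∀ {x} → x ∈ C¹.list v¹ → f (κ¹ x) ≡ C¹.f x + C².f (π x)

data Constructible (𝒞 : Configuration) : Set where
  K1 : IsUniform 𝒞 → IsMConfiguration 𝒞 → Constructible 𝒞
  K2 : IsUniform 𝒞 → IsKConfiguration 𝒞 → Constructible 𝒞
  K3 : IsUniform 𝒞 → IsOddCConfiguration 𝒞 → Constructible 𝒞
  K4 : IsUniform 𝒞 → IsEvenCConfiguration 𝒞 → Constructible 𝒞
  K5 : IsUniform 𝒞 → ∀ {𝒞¹ 𝒞²} → Constructible 𝒞¹ → Constructible 𝒞² →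
       IsMerge 𝒞¹ 𝒞² 𝒞 → Constructible 𝒞

{-# OPTIONS --safe #-}
-- Part (b) follows from a positive statement that survives merging: for every
-- choice τ of a vertex τ v ∈ X v for each v there is a non-empty W ⊆ V(G) such
-- that each τ v with v ∈ W has degree at least f (τ v) in H[τ(W)].  A vertex
-- with f (τ v) = 0 gives W = {v}.  Otherwise τ stays inside the sets U, and W
-- is V(G) for an M-configuration, a colour class with more than nᵢ vertices
-- for a K-configuration (Σ nᵢ < n), and the ends of an edge joining equal
-- colours (n odd) or consecutive vertices of the 2n-cycle (n even) for a
-- C-configuration.  In a merge, the set W of a piece still works if it avoids
-- the identified vertex; if both contain it, their union works, since
-- degrees and values of f add up at the identified vertex.
module Submission where

open import Defs
open import Data.Bool using (Bool; true; false; not; if_then_else_)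
open import Data.Bool.Properties using (not-involutive; ¬-not) renaming (_≟_ to _≟ᵇ_)
open import Data.Fin using (Fin; zero; suc; toℕ; fromℕ; fromℕ<; inject₁; _↑ˡ_; _↑ʳ_; _≟_)
open import Data.Fin.Properties using (any?; ¬∀⟶∃¬; nonZeroIndex; suc-injective; toℕ<n; toℕ-injective; toℕ-fromℕ; toℕ-fromℕ<; toℕ-inject₁; toℕ-↑ˡ; toℕ-↑ʳ)
open import Data.Fin.Subset using (Subset; _∈_; _∉_; _⊆_; _∩_; _∪_; ⁅_⁆; ∣_∣; Nonempty; Empty; ⊥; ⊤)
open import Data.Fin.Subset.Properties using (_∈?_; ∈⊤; ∉⊥; p∩q⊆p; p∩q⊆q; p⊆p∪q; q⊆p∪q; x∈p∩q⁺; x∈p∩q⁻; x∈p∪q⁻; x∈⁅x⁆; x∈⁅y⁆⇒x≡y; x∉⁅y⁆⇒x≢y; x≢y⇒x∉⁅y⁆; ⊆-antisym; ⊆⊤)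
open import Data.Nat using (ℕ; zero; suc; _+_; _*_; _∸_; _%_; _≤_; _<_; _≤?_; z≤n; s≤s; >-nonZero)
open import Data.Nat.DivMod using (m%n<n; m<n⇒m%n≡m; n%n≡0)
open import Data.Nat.Divisibility using (_∣_; _∤_; ∣-refl; ∣1⇒≡1; ∣m∣n⇒∣m+n; ∣m+n∣m⇒∣n)
open import Data.Nat.Properties hiding (_≟_; suc-injective; _≤?_)
import Data.Nat.Properties as ℕ using (_≟_; suc-injective)
open import Data.Product using (∃; ∃-syntax; _×_; _,_; proj₁; proj₂)
open import Data.Sum using (_⊎_; inj₁; inj₂; [_,_]′)
open import Data.Vec using ([]; _∷_; here; there; lookup; tabulate)
open import Data.Vec.Properties using (lookup⇒[]=; []=⇒lookup; lookup∘tabulate)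
open import Function using (_∘_; _⇔_; mk⇔; Equivalence)
open import Relation.Binary.PropositionalEquality using (_≡_; _≢_; refl; sym; trans; cong; cong₂; subst; subst₂; module ≡-Reasoning)
open import Relation.Nullary using (¬_; Dec; yes; no; does; contradiction)
open import Relation.Nullary.Decidable using (dec-true; decidable-stable; _×-dec_)
open import Relation.Unary using (Decidable)
open import Algebra.Properties.Semiring.Sum +-*-semiring using (sum-cong-≗; ∑-distrib-+; ∑-comm; *-distribʳ-sum; *-distribˡ-sum)

-- Sums over subsets

-- A bare refutation of strict degeneracy would leave nothing to glue at the identified vertex of a
-- merge, so the violating set has to be produced as data. It consists of vertices of `G` rather
-- than of colours: lists are disjoint, hence `τ` is injective on `W` and a degree in `H[τ(W)]` is a
-- sum over `W`. All choices `τ` are covered because a choice for a merge restricts to a choice for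
-- each piece, and the two colours picked at the identified vertex correspond under `π`.
--
-- Inflations are removed by scaling. Within a set `U` a list has `s` colours (`2s` over a double
-- cover), `f` is a quotient by that number, and multiplicities are those of the cover before
-- inflation divided by `s`. After multiplication by `s`, a base case compares degrees in `G`, or
-- the value `t` with one edge of multiplicity `t`.

restrict : ∀ {n} → Subset n → (Fin n → ℕ) → Fin n → ℕ
restrict S f x = if lookup S x then f x else 0

if-∈ : ∀ {n} {S : Subset n} {x} {a b : ℕ} → x ∈ S → (if lookup S x then a else b) ≡ a
if-∈ x∈S rewrite []=⇒lookup x∈S = refl

if-∉ : ∀ {n} {S : Subset n} {x} {a b : ℕ} → x ∉ S → (if lookup S x then a else b) ≡ b
if-∉ {S = S} {x} x∉S with lookup S x in eq
... | true  = contradiction (lookup⇒[]= x S eq) x∉S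
... | false = refl

sum-mono-≤ : ∀ {n} {f g : Fin n → ℕ} → (∀ x → f x ≤ g x) → sum f ≤ sum g
sum-mono-≤ {zero}  f≤g = z≤n
sum-mono-≤ {suc n} f≤g = +-mono-≤ (f≤g zero) (sum-mono-≤ (f≤g ∘ suc))

sumOver-mono-≤ : ∀ {n} (S : Subset n) {f g : Fin n → ℕ} → (∀ {x} → x ∈ S → f x ≤ g x) →
                 sumOver S f ≤ sumOver S g
sumOver-mono-≤ S {f} {g} f≤g = sum-mono-≤ pointwise
  where
  pointwise : ∀ x → restrict S f x ≤ restrict S g x
  pointwise x with lookup S x in eq
  ... | true  = f≤g (lookup⇒[]= x S eq)
  ... | false = z≤n

sumOver-cong : ∀ {n} (S : Subset n) {f g : Fin n → ℕ} → (∀ {x} → x ∈ S → f x ≡ g x) →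
               sumOver S f ≡ sumOver S g
sumOver-cong S f≡g =
  ≤-antisym (sumOver-mono-≤ S (≤-reflexive ∘ f≡g)) (sumOver-mono-≤ S (≤-reflexive ∘ sym ∘ f≡g))

sumOver-⊆ : ∀ {n} {S S′ : Subset n} (f : Fin n → ℕ) → S ⊆ S′ → sumOver S f ≤ sumOver S′ f
sumOver-⊆ {S = S} {S′} f S⊆S′ = sum-mono-≤ pointwise
  where
  pointwise : ∀ x → restrict S f x ≤ restrict S′ f x
  pointwise x with lookup S x in eq
  ... | true  = ≤-reflexive (sym (if-∈ (S⊆S′ (lookup⇒[]= x S eq))))
  ... | false = z≤n

sumOver≤sum : ∀ {n} (S : Subset n) (f : Fin n → ℕ) → sumOver S f ≤ sum f
sumOver≤sum S f = sum-mono-≤ pointwise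
  where
  pointwise : ∀ x → restrict S f x ≤ f x
  pointwise x with lookup S x
  ... | true  = ≤-refl
  ... | false = z≤n

sum-support : ∀ {n} (S : Subset n) (f : Fin n → ℕ) → (∀ x → x ∉ S → f x ≡ 0) → sum f ≡ sumOver S f
sum-support S f f≡0 = sum-cong-≗ pointwise
  where
  pointwise : ∀ x → f x ≡ restrict S f x
  pointwise x with x ∈? S
  ... | yes x∈S = sym (if-∈ x∈S)
  ... | no  x∉S = trans (f≡0 x x∉S) (sym (if-∉ x∉S))

sumOver-support : ∀ {n} {S S′ : Subset n} (f : Fin n → ℕ) → S ⊆ S′ →
                  (∀ {x} → x ∈ S′ → x ∉ S → f x ≡ 0) → sumOver S′ f ≡ sumOver S f
sumOver-support {S = S} {S′} f S⊆S′ f≡0 = sum-cong-≗ pointwise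
  where
  pointwise : ∀ x → restrict S′ f x ≡ restrict S f x
  pointwise x with x ∈? S | x ∈? S′
  ... | yes x∈S | _        = trans (if-∈ (S⊆S′ x∈S)) (sym (if-∈ x∈S))
  ... | no  x∉S | yes x∈S′ = trans (trans (if-∈ x∈S′) (f≡0 x∈S′ x∉S)) (sym (if-∉ x∉S))
  ... | no  x∉S | no  x∉S′ = trans (if-∉ x∉S′) (sym (if-∉ x∉S))

-- Overlap is tolerated where `f` vanishes: the two sides of a merge share the identified vertex,
-- whose entry in its own row of multiplicities is zero because there are no loops.
sumOver-∪ : ∀ {n} (A B : Subset n) (f : Fin n → ℕ) → (∀ {x} → x ∈ A → x ∈ B → f x ≡ 0) →
            sumOver (A ∪ B) f ≡ sumOver A f + sumOver B f
sumOver-∪ A B f f≡0 = trans (sum-cong-≗ pointwise) (∑-distrib-+ (restrict A f) (restrict B f))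
  where
  pointwise : ∀ x → restrict (A ∪ B) f x ≡
                    restrict A f x + restrict B f x
  pointwise x with x ∈? A | x ∈? B
  ... | yes x∈A | yes x∈B rewrite []=⇒lookup x∈A | []=⇒lookup x∈B | f≡0 x∈A x∈B =
    if-∈ (p⊆p∪q B x∈A)
  ... | yes x∈A | no  x∉B = trans (if-∈ (p⊆p∪q B x∈A))
    (sym (trans (cong₂ _+_ (if-∈ x∈A) (if-∉ x∉B)) (+-identityʳ (f x))))
  ... | no  x∉A | yes x∈B = trans (if-∈ (q⊆p∪q A B x∈B))
    (sym (cong₂ _+_ (if-∉ x∉A) (if-∈ x∈B)))
  ... | no  x∉A | no  x∉B = trans (if-∉ ([ x∉A , x∉B ]′ ∘ x∈p∪q⁻ A B))
    (sym (cong₂ _+_ (if-∉ x∉A) (if-∉ x∉B)))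

sumOver-const : ∀ {n} (S : Subset n) d → sumOver S (λ _ → d) ≡ ∣ S ∣ * d
sumOver-const []          d = refl
sumOver-const (true ∷ S)  d = cong (d +_) (sumOver-const S d)
sumOver-const (false ∷ S) d = sumOver-const S d

sumOver-+ : ∀ {n} (S : Subset n) (f g : Fin n → ℕ) →
            sumOver S (λ x → f x + g x) ≡ sumOver S f + sumOver S g
sumOver-+ S f g = trans (sum-cong-≗ pointwise) (∑-distrib-+ (restrict S f) (restrict S g))
  where
  pointwise : ∀ x → restrict S (λ y → f y + g y) x ≡ restrict S f x + restrict S g x
  pointwise x with lookup S x
  ... | true  = refl
  ... | false = refl

sumOver-*ʳ : ∀ {n} (S : Subset n) (f : Fin n → ℕ) c → sumOver S f * c ≡ sumOver S (λ x → f x * c)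
sumOver-*ʳ S f c = trans (*-distribʳ-sum c (restrict S f)) (sum-cong-≗ pointwise)
  where
  pointwise : ∀ x → restrict S f x * c ≡ (if lookup S x then f x * c else 0)
  pointwise x with lookup S x
  ... | true  = refl
  ... | false = refl

sumOver-⊥ : ∀ {n} (f : Fin n → ℕ) → sumOver ⊥ f ≡ 0
sumOver-⊥ {zero}  f = refl
sumOver-⊥ {suc n} f = sumOver-⊥ (f ∘ suc)

sumOver-⁅⁆ : ∀ {n} (x : Fin n) (f : Fin n → ℕ) → sumOver ⁅ x ⁆ f ≡ f x
sumOver-⁅⁆ zero    f = trans (cong (f zero +_) (sumOver-⊥ (f ∘ suc))) (+-identityʳ (f zero))
sumOver-⁅⁆ (suc x) f = sumOver-⁅⁆ x (f ∘ suc)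

∈⇒≤sumOver : ∀ {n} {S : Subset n} {x} (f : Fin n → ℕ) → x ∈ S → f x ≤ sumOver S f
∈⇒≤sumOver {S = S} {x} f x∈S = subst (_≤ sumOver S f) (sumOver-⁅⁆ x f)
  (sumOver-⊆ f λ y∈⁅x⁆ → subst (_∈ S) (sym (x∈⁅y⁆⇒x≡y x y∈⁅x⁆)) x∈S)

-- Images of subsets, finite choice and double counting.

image : ∀ {a b} → (Fin a → Fin b) → Subset a → Subset b
image φ []          = ⊥
image φ (true ∷ S)  = ⁅ φ zero ⁆ ∪ image (φ ∘ suc) S
image φ (false ∷ S) = image (φ ∘ suc) S

∈-image⁺ : ∀ {a b} (φ : Fin a → Fin b) {S : Subset a} {x} → x ∈ S → φ x ∈ image φ S
∈-image⁺ φ here = p⊆p∪q _ (x∈⁅x⁆ (φ zero))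
∈-image⁺ φ {true ∷ S}  (there x∈S) = q⊆p∪q ⁅ φ zero ⁆ _ (∈-image⁺ (φ ∘ suc) x∈S)
∈-image⁺ φ {false ∷ S} (there x∈S) = ∈-image⁺ (φ ∘ suc) x∈S

∈-image⁻ : ∀ {a b} (φ : Fin a → Fin b) (S : Subset a) {y} → y ∈ image φ S → ∃[ x ] x ∈ S × φ x ≡ y
∈-image⁻ φ [] y∈ = contradiction y∈ ∉⊥
∈-image⁻ φ (false ∷ S) y∈ with ∈-image⁻ (φ ∘ suc) S y∈
... | x , x∈S , eq = suc x , there x∈S , eq
∈-image⁻ φ (true ∷ S) y∈ with x∈p∪q⁻ ⁅ φ zero ⁆ _ y∈
... | inj₁ y∈⁅⁆ = zero , here , sym (x∈⁅y⁆⇒x≡y _ y∈⁅⁆)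
... | inj₂ y∈im with ∈-image⁻ (φ ∘ suc) S y∈im
...   | x , x∈S , eq = suc x , there x∈S , eq

InjectiveOn : ∀ {a b} → Subset a → (Fin a → Fin b) → Set
InjectiveOn S φ = ∀ {x y} → x ∈ S → y ∈ S → φ x ≡ φ y → x ≡ y

sumOver-image : ∀ {a b} (φ : Fin a → Fin b) (S : Subset a) → InjectiveOn S φ → (g : Fin b → ℕ) →
                sumOver (image φ S) g ≡ sumOver S (g ∘ φ)
sumOver-image φ []          inj g = sumOver-⊥ g
sumOver-image φ (false ∷ S) inj g =
  sumOver-image (φ ∘ suc) S (λ p q → suc-injective ∘ inj (there p) (there q)) g
sumOver-image φ (true ∷ S)  inj g = trans
  (sumOver-∪ ⁅ φ zero ⁆ (image (φ ∘ suc) S) g disjoint)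
  (cong₂ _+_ (sumOver-⁅⁆ (φ zero) g)
    (sumOver-image (φ ∘ suc) S (λ p q → suc-injective ∘ inj (there p) (there q)) g))
  where
  disjoint : ∀ {y} → y ∈ ⁅ φ zero ⁆ → y ∈ image (φ ∘ suc) S → g y ≡ 0
  disjoint y∈⁅⁆ y∈im with ∈-image⁻ (φ ∘ suc) S y∈im
  ... | x , x∈S , eq with inj here (there x∈S) (sym (trans eq (x∈⁅y⁆⇒x≡y _ y∈⁅⁆)))
  ...   | ()

-- Vertex sets and lists are specified by membership equivalences; an equality of subsets is what
-- allows `sumOver-image` to be applied to them.
image-unique : ∀ {a b} (φ : Fin a → Fin b) {S : Subset a} {S′ : Subset b} →
               (∀ y → y ∈ S′ ⇔ (∃[ x ] x ∈ S × φ x ≡ y)) → S′ ≡ image φ S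
image-unique φ {S} {S′} char = ⊆-antisym to from
  where
  to : S′ ⊆ image φ S
  to y∈S′ with Equivalence.to (char _) y∈S′
  ... | x , x∈S , refl = ∈-image⁺ φ x∈S
  from : image φ S ⊆ S′
  from y∈im = Equivalence.from (char _) (∈-image⁻ φ S y∈im)

comprehension : ∀ {n} {P : Fin n → Set} → Decidable P → Subset n
comprehension P? = tabulate (does ∘ P?)

∈-comprehension⁺ : ∀ {n} {P : Fin n → Set} (P? : Decidable P) {x} → P x → x ∈ comprehension P?
∈-comprehension⁺ P? {x} px =
  lookup⇒[]= x _ (trans (lookup∘tabulate (does ∘ P?) x) (dec-true (P? x) px))

∈-comprehension⁻ : ∀ {n} {P : Fin n → Set} (P? : Decidable P) {x} → x ∈ comprehension P? → P x
∈-comprehension⁻ P? {x} x∈ with P? x | trans (sym (lookup∘tabulate (does ∘ P?) x)) ([]=⇒lookup x∈)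
... | yes px | _  = px
... | no  _  | ()

-- The quotient `d / ∣ S ∣` is added `∣ S ∣` times. As quotients are encoded by products, the sum is
-- first multiplied by `∣ S ∣` and the factor cancelled at the end.
sumOver-quotients : ∀ {n} (S : Subset n) (f : Fin n → ℕ) d → 1 ≤ ∣ S ∣ →
                    (∀ {x} → x ∈ S → f x * ∣ S ∣ ≡ d) → sumOver S f ≡ d
sumOver-quotients S f d ∣S∣≥1 f*∣S∣≡d = *-cancelʳ-≡ _ _ ∣ S ∣ {{>-nonZero ∣S∣≥1}} (begin
  sumOver S f * ∣ S ∣            ≡⟨ sumOver-*ʳ S f ∣ S ∣ ⟩
  sumOver S (λ x → f x * ∣ S ∣)  ≡⟨ sumOver-cong S f*∣S∣≡d ⟩
  sumOver S (λ _ → d)            ≡⟨ sumOver-const S d ⟩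
  ∣ S ∣ * d                      ≡⟨ *-comm ∣ S ∣ d ⟩
  d * ∣ S ∣                      ∎)
  where open ≡-Reasoning

∣S∣≥1⇒nonempty : ∀ {n} (S : Subset n) → 1 ≤ ∣ S ∣ → Nonempty S
∣S∣≥1⇒nonempty (true ∷ S)  _ = zero , here
∣S∣≥1⇒nonempty (false ∷ S) p with ∣S∣≥1⇒nonempty S p
... | x , x∈S = suc x , there x∈S

-- Finite choice. The function must be total on labels, so outside `S` it takes the value found at
-- the given point of `S`.
choose : ∀ {n m} {S : Subset n} {P : Fin n → Fin m → Set} → Nonempty S →
         (∀ {v} → v ∈ S → ∃ (P v)) → ∃ λ (τ : Fin n → Fin m) → ∀ {v} → v ∈ S → P v (τ v)
choose {n} {m} {S} {P} (v₀ , v₀∈S) ex = τ , τ-spec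
  where
  τ : Fin n → Fin m
  τ v with v ∈? S
  ... | yes v∈S = proj₁ (ex v∈S)
  ... | no  _   = proj₁ (ex v₀∈S)
  τ-spec : ∀ {v} → v ∈ S → P v (τ v)
  τ-spec {v} v∈S with v ∈? S
  ... | yes v∈S′ = proj₂ (ex v∈S′)
  ... | no  v∉S  = contradiction v∈S v∉S

sum-zero : ∀ {n} (h : Fin n → ℕ) → (∀ i → h i ≡ 0) → sum h ≡ 0
sum-zero h h≡0 = trans (sum-support ⊥ h (λ i _ → h≡0 i)) (sumOver-⊥ h)

≤sum : ∀ {n} (h : Fin n → ℕ) i → h i ≤ sum h
≤sum h i = ≤-trans (∈⇒≤sumOver h (x∈⁅x⁆ i)) (sumOver≤sum ⁅ i ⁆ h)

-- Double counting: an element of `L` lies in exactly one `U i` and is counted once, or it lies in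
-- none and contributes zero.
sumOver-partition : ∀ {n p} (L : Subset n) (U : Fin p → Subset n) (f : Fin n → ℕ) →
                    (∀ i j → i ≢ j → Empty (U i ∩ U j)) →
                    (∀ {x} → x ∈ L → (∀ i → x ∉ U i) → f x ≡ 0) →
                    sumOver L f ≡ sum (λ i → sumOver (L ∩ U i) f)
sumOver-partition L U f U-disjoint f≡0 = trans (sum-cong-≗ pointwise) (∑-comm λ x i → restrict (L ∩ U i) f x)
  where
  pointwise : ∀ x → restrict L f x ≡ sum (λ i → restrict (L ∩ U i) f x)
  pointwise x with x ∈? L
  ... | no x∉L = trans (if-∉ x∉L) (sym (sum-zero _ λ i → if-∉ (x∉L ∘ p∩q⊆p L (U i))))
  ... | yes x∈L with any? (λ i → x ∈? U i)
  ...   | no x∉U = trans (if-∈ x∈L) (trans (f≡0 x∈L λ i x∈U → x∉U (i , x∈U))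
    (sym (sum-zero _ λ i → if-∉ λ x∈ → x∉U (i , p∩q⊆q L (U i) x∈))))
  ...   | yes (i₀ , x∈U) = sym (begin
    sum (λ i → restrict (L ∩ U i) f x)             ≡⟨ sum-support ⁅ i₀ ⁆ _ (λ i i∉ → if-∉ λ x∈ →
      U-disjoint i₀ i (x∉⁅y⁆⇒x≢y i∉ ∘ sym) (x , x∈p∩q⁺ (x∈U , p∩q⊆q L (U i) x∈))) ⟩
    sumOver ⁅ i₀ ⁆ (λ i → restrict (L ∩ U i) f x)  ≡⟨ sumOver-⁅⁆ i₀ (λ i → restrict (L ∩ U i) f x) ⟩
    restrict (L ∩ U i₀) f x                        ≡⟨ if-∈ (x∈p∩q⁺ (x∈L , x∈U)) ⟩
    f x                                            ≡⟨ if-∈ x∈L ⟨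
    restrict L f x                                 ∎)
    where open ≡-Reasoning

∣S∣≡sum : ∀ {n} (S : Subset n) → ∣ S ∣ ≡ sumOver S (λ _ → 1)
∣S∣≡sum S = sym (trans (sumOver-const S 1) (*-identityʳ ∣ S ∣))

-- If every `∣ W i ∣` were at most `ns i`, counting the pairs of a point and a class containing it
-- would give `∣ S ∣ ≤ sum ns`. Comparison of numbers is decidable, so an actual index is obtained.
pigeonhole-cover : ∀ {n p} (S : Subset n) (W : Fin p → Subset n) (ns : Fin p → ℕ) →
                   (∀ {v} → v ∈ S → ∃[ i ] v ∈ W i) → sum ns < ∣ S ∣ → ∃[ i ] ns i < ∣ W i ∣
pigeonhole-cover {p = p} S W ns covered sum<
  with ¬∀⟶∃¬ p (λ i → ∣ W i ∣ ≤ ns i) (λ i → ∣ W i ∣ ≤? ns i)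
         (λ all≤ → <⇒≱ sum< (≤-trans ∣S∣≤ (sum-mono-≤ all≤)))
  where
  ones : Subset _ → Fin _ → ℕ
  ones S′ = restrict S′ (λ _ → 1)
  pointwise : ∀ v → ones S v ≤ sum (λ i → ones (W i) v)
  pointwise v with v ∈? S
  ... | no  v∉S = ≤-trans (≤-reflexive (if-∉ v∉S)) z≤n
  ... | yes v∈S with covered v∈S
  ...   | i , v∈W = ≤-trans (≤-reflexive (trans (if-∈ v∈S) (sym (if-∈ v∈W)))) (≤sum (λ i → ones (W i) v) i)
  ∣S∣≤ : ∣ S ∣ ≤ sum (λ i → ∣ W i ∣)
  ∣S∣≤ = begin
    ∣ S ∣                                ≡⟨ ∣S∣≡sum S ⟩
    sum (ones S)                         ≤⟨ sum-mono-≤ pointwise ⟩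
    sum (λ v → sum (λ i → ones (W i) v)) ≡⟨ ∑-comm (λ v i → ones (W i) v) ⟩
    sum (λ i → sum (ones (W i)))         ≡⟨ sum-cong-≗ (∣S∣≡sum ∘ W) ⟨
    sum (λ i → ∣ W i ∣)                  ∎
    where open ≤-Reasoning
... | i , ≰ = i , ≰⇒> ≰

-- Obstructions to colorings

IsSelector : ∀ {n m} → Graph n → CoverData n m → (Fin n → Fin m) → Set
IsSelector G C τ = ∀ {v} → v ∈ V G → τ v ∈ X C v

-- The set of all τ v with v ∈ W induces a subgraph of H that violates strict
-- f-degeneracy of the transversal chosen by τ.
record Obstruction (𝒞 : Configuration) (τ : Fin (Configuration.n 𝒞) → Fin (Configuration.m 𝒞)) : Set where
  open Configuration 𝒞
  field
    W        : Subset n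
    W⊆V      : W ⊆ V graph
    nonempty : Nonempty W
    f≤deg    : ∀ {v} → v ∈ W → f (τ v) ≤ sumOver W (λ u → μ coverGraph (τ v) (τ u))

-- The invariant of the induction over constructible configurations. Non-emptiness is part of it
-- because turning a transversal into a selector by `choose` needs a vertex for the default value.
record Balanced (𝒞 : Configuration) : Set where
  open Configuration 𝒞
  field
    nonempty    : Nonempty (V graph)
    degree-sum  : ∀ {v} → v ∈ V graph → sumOver (list v) f ≡ deg graph v
    obstruction : ∀ τ → IsSelector graph cover τ → Obstruction 𝒞 τ

deg≡sumOver : ∀ {n} (G : Graph n) v → deg G v ≡ sumOver (V G) (μ G v)
deg≡sumOver G v = sum-support (V G) (μ G v) outside
  where
  outside : ∀ u → u ∉ V G → μ G v u ≡ 0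
  outside u u∉V with μ G v u ℕ.≟ 0
  ... | yes μ≡0 = μ≡0
  ... | no  μ≢0 = contradiction (supported G u v (μ≢0 ∘ trans (symmetric G v u))) u∉V

deg-induced : ∀ {n} (G : Graph n) (W : Subset n) {v} → v ∈ W → deg (induced G W) v ≡ sumOver W (μ G v)
deg-induced G W {v} v∈W rewrite []=⇒lookup v∈W = refl

induced-⊑ : ∀ {n} (G : Graph n) {W W′ : Subset n} → W ⊆ W′ → induced G W ⊑ induced G W′
induced-⊑ G {W} {W′} W⊆W′ = record { V-⊆ = V-⊆ ; μ-≤ = μ-≤ }
  where
  V-⊆ : V G ∩ W ⊆ V G ∩ W′
  V-⊆ x∈ with x∈p∩q⁻ (V G) W x∈
  ... | x∈V , x∈W = x∈p∩q⁺ (x∈V , W⊆W′ x∈W)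
  μ-≤ : ∀ u v → μ (induced G W) u v ≤ μ (induced G W′) u v
  μ-≤ u v with lookup W u in equ | lookup W v in eqv
  ... | true  | false = z≤n
  ... | false | _     = z≤n
  ... | true  | true
    rewrite []=⇒lookup (W⊆W′ (lookup⇒[]= u W equ)) | []=⇒lookup (W⊆W′ (lookup⇒[]= v W eqv)) = ≤-refl

list⊆V : ∀ {n m} {G : Graph n} {C : CoverData n m} → IsCover G C →
         ∀ {v x} → v ∈ V G → x ∈ X C v → x ∈ V (H C)
list⊆V isCover v∈V x∈X = Equivalence.from (IsCover.union isCover _) (_ , v∈V , x∈X)

lists-determine-vertex : ∀ {n m} {G : Graph n} {C : CoverData n m} → IsCover G C →
                         ∀ {u v x} → u ∈ V G → v ∈ V G → x ∈ X C u → x ∈ X C v → u ≡ v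
lists-determine-vertex isCover {u} {v} u∈V v∈V x∈Xu x∈Xv with u ≟ v
... | yes u≡v = u≡v
... | no  u≢v = contradiction (_ , x∈p∩q⁺ (x∈Xu , x∈Xv)) (IsCover.disjoint isCover u∈V v∈V u≢v)

-- A transversal yields a selector `τ`, hence a set `W`. Strict degeneracy is tested on the subgraph
-- induced by the image of `W`; since `τ` is injective there, the degree of `τ v` in it is exactly
-- the sum that `f≤deg` bounds from below.
balanced⇒uncolorable : ∀ {𝒞} → Balanced 𝒞 → Uncolorable 𝒞
balanced⇒uncolorable {𝒞} balanced (T , (T⊆V , ∣T∩X∣≡1) , degenerate) = refute
  (choose (Balanced.nonempty balanced) λ {v} v∈V →
    ∣S∣≥1⇒nonempty (T ∩ list v) (≤-reflexive (sym (∣T∩X∣≡1 v∈V))))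
  where
  open Configuration 𝒞
  refute : ¬ (∃ λ (τ : Fin n → Fin m) → ∀ {v} → v ∈ V graph → τ v ∈ T ∩ list v)
  refute (τ , τ∈) = refute-subgraph (degenerate (induced coverGraph I) (induced-⊑ coverGraph I⊆T)
      (_ , x∈p∩q⁺ (T⊆V (τ∈T v₀∈W) , ∈-image⁺ τ v₀∈W)))
    where
    τ∈X : IsSelector graph cover τ
    τ∈X v∈V = proj₂ (x∈p∩q⁻ T _ (τ∈ v∈V))
    open Obstruction (Balanced.obstruction balanced τ τ∈X)
    v₀∈W = proj₂ nonempty
    I = image τ W
    τ∈T : ∀ {v} → v ∈ W → τ v ∈ T
    τ∈T v∈W = proj₁ (x∈p∩q⁻ T _ (τ∈ (W⊆V v∈W)))
    I⊆T : I ⊆ T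
    I⊆T x∈I with ∈-image⁻ τ W x∈I
    ... | v , v∈W , refl = τ∈T v∈W
    τ-injective : InjectiveOn W τ
    τ-injective u∈W v∈W τu≡τv = lists-determine-vertex isCover (W⊆V u∈W) (W⊆V v∈W)
      (τ∈X (W⊆V u∈W)) (subst (_∈ _) (sym τu≡τv) (τ∈X (W⊆V v∈W)))
    refute-subgraph : ¬ (∃[ x ] x ∈ V coverGraph ∩ I × deg (induced coverGraph I) x < f x)
    refute-subgraph (x , x∈ , deg<f) with ∈-image⁻ τ W (proj₂ (x∈p∩q⁻ (V coverGraph) I x∈))
    ... | v , v∈W , refl = <⇒≱ deg<f (≤-trans (f≤deg v∈W) (≤-reflexive (sym (trans
      (deg-induced coverGraph I (∈-image⁺ τ v∈W))
      (sumOver-image τ W τ-injective _)))))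

vertex-obstruction : ∀ {𝒞 τ v} → let open Configuration 𝒞 in v ∈ V graph → f (τ v) ≡ 0 → Obstruction 𝒞 τ
vertex-obstruction {𝒞} {τ} {v} v∈V f≡0 = record
  { W        = ⁅ v ⁆
  ; W⊆V      = λ u∈ → subst (_∈ V graph) (sym (x∈⁅y⁆⇒x≡y v u∈)) v∈V
  ; nonempty = v , x∈⁅x⁆ v
  ; f≤deg    = λ u∈ → ≤-trans (≤-reflexive (trans (cong (f ∘ τ) (x∈⁅y⁆⇒x≡y v u∈)) f≡0)) z≤n
  }
  where open Configuration 𝒞

edge-obstruction : ∀ {𝒞 τ u v} → let open Configuration 𝒞 in u ∈ V graph → v ∈ V graph →
                   f (τ u) ≤ μ coverGraph (τ u) (τ v) → f (τ v) ≤ μ coverGraph (τ u) (τ v) →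
                   Obstruction 𝒞 τ
edge-obstruction {𝒞} {τ} {u} {v} u∈V v∈V fu≤μ fv≤μ = record
  { W        = ⁅ u ⁆ ∪ ⁅ v ⁆
  ; W⊆V      = W⊆V
  ; nonempty = u , p⊆p∪q _ (x∈⁅x⁆ u)
  ; f≤deg    = f≤deg
  }
  where
  open Configuration 𝒞
  W⊆V : ⁅ u ⁆ ∪ ⁅ v ⁆ ⊆ V graph
  W⊆V w∈ with x∈p∪q⁻ ⁅ u ⁆ ⁅ v ⁆ w∈
  ... | inj₁ w∈ = subst (_∈ V graph) (sym (x∈⁅y⁆⇒x≡y u w∈)) u∈V
  ... | inj₂ w∈ = subst (_∈ V graph) (sym (x∈⁅y⁆⇒x≡y v w∈)) v∈V
  f≤deg : ∀ {w} → w ∈ ⁅ u ⁆ ∪ ⁅ v ⁆ →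
          f (τ w) ≤ sumOver (⁅ u ⁆ ∪ ⁅ v ⁆) (λ z → μ coverGraph (τ w) (τ z))
  f≤deg w∈ with x∈p∪q⁻ ⁅ u ⁆ ⁅ v ⁆ w∈
  ... | inj₁ w∈ rewrite x∈⁅y⁆⇒x≡y u w∈ =
    ≤-trans fu≤μ (∈⇒≤sumOver (λ z → μ coverGraph (τ u) (τ z)) (q⊆p∪q ⁅ u ⁆ _ (x∈⁅x⁆ v)))
  ... | inj₂ w∈ rewrite x∈⁅y⁆⇒x≡y v w∈ =
    ≤-trans (≤-trans fv≤μ (≤-reflexive (symmetric coverGraph (τ u) (τ v))))
      (∈⇒≤sumOver (λ z → μ coverGraph (τ v) (τ z)) (p⊆p∪q {p = ⁅ u ⁆} ⁅ v ⁆ (x∈⁅x⁆ u)))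

obstruction-if-positive : ∀ {𝒞 τ} → let open Configuration 𝒞 in
                          ((∀ {v} → v ∈ V graph → f (τ v) ≢ 0) → Obstruction 𝒞 τ) → Obstruction 𝒞 τ
obstruction-if-positive {𝒞} {τ} construct with any? (λ v → v ∈? V graph ×-dec (f (τ v) ℕ.≟ 0))
  where open Configuration 𝒞
... | yes (v , v∈V , f≡0) = vertex-obstruction {𝒞} v∈V f≡0
... | no  none            = construct λ v∈V f≡0 → none (_ , v∈V , f≡0)

-- Merging configurations

-- How 𝒞 looks from one side 𝒞′ of a merge at v*; both sides satisfy this.
record Piece (𝒞′ 𝒞 : Configuration) : Set where
  private
    module P = Configuration 𝒞′
    module C = Configuration 𝒞
  field
    v*         : Fin P.n
    ι          : Fin P.n → Fin C.n
    κ          : Fin P.m → Fin C.m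
    ι∈V        : ∀ {u} → u ∈ V P.graph → ι u ∈ V C.graph
    ι-inj      : InjectiveOn (V P.graph) ι
    κ-inj      : InjectiveOn (V P.coverGraph) κ
    ι-mult     : ∀ {u v} → u ∈ V P.graph → v ∈ V P.graph → μ C.graph (ι u) (ι v) ≡ μ P.graph u v
    κ-mult     : ∀ {x y} → x ∈ V P.coverGraph → y ∈ V P.coverGraph →
                 μ C.coverGraph (κ x) (κ y) ≡ μ P.coverGraph x y
    lists      : ∀ {v} → v ∈ V P.graph → ∀ y → y ∈ C.list (ι v) ⇔ (∃[ x ] x ∈ P.list v × κ x ≡ y)
    f-private  : ∀ {x} → x ∈ V P.coverGraph → x ∉ P.list v* → C.f (κ x) ≡ P.f x
    neighbours : ∀ {u w} → u ∈ V P.graph → u ≢ v* → μ C.graph (ι u) w ≢ 0 → w ∈ image ι (V P.graph)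
    v*∈V       : v* ∈ V P.graph

module _ {𝒞′ 𝒞 : Configuration} (piece : Piece 𝒞′ 𝒞) where
  open Piece piece
  private
    module P = Configuration 𝒞′
    module C = Configuration 𝒞

  -- Lists of distinct vertices are disjoint, so no colour of `u` gets identified and `f-private`
  -- applies to all of them.
  private-label : ∀ {u x} → u ∈ V P.graph → u ≢ v* → x ∈ P.list u → x ∉ P.list v*
  private-label u∈V u≢v* x∈Xu x∈Xv* = u≢v* (lists-determine-vertex P.isCover u∈V v*∈V x∈Xu x∈Xv*)

  sumOver-list : ∀ {u} → u ∈ V P.graph → (g : Fin C.m → ℕ) →
                 sumOver (C.list (ι u)) g ≡ sumOver (P.list u) (g ∘ κ)
  sumOver-list {u} u∈V g = trans (cong (λ S → sumOver S g) (image-unique κ (lists u∈V)))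
    (sumOver-image κ (P.list u)
      (λ x∈ y∈ → κ-inj (list⊆V P.isCover u∈V x∈) (list⊆V P.isCover u∈V y∈)) g)

  sumOver-vertices : ∀ {u} → u ∈ V P.graph →
                     sumOver (image ι (V P.graph)) (μ C.graph (ι u)) ≡ deg P.graph u
  sumOver-vertices {u} u∈V = begin
    sumOver (image ι (V P.graph)) (μ C.graph (ι u))  ≡⟨ sumOver-image ι (V P.graph) ι-inj _ ⟩
    sumOver (V P.graph) (μ C.graph (ι u) ∘ ι)        ≡⟨ sumOver-cong (V P.graph) (ι-mult u∈V) ⟩
    sumOver (V P.graph) (μ P.graph u)                ≡⟨ deg≡sumOver P.graph u ⟨
    deg P.graph u                                    ∎
    where open ≡-Reasoning

  -- Away from the identified vertex nothing changes: the list is copied by `κ` with the same values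
  -- of `f`, and by `neighbours` every edge at `ι u` comes from the piece.
  private-degree-sum : ∀ {u} → u ∈ V P.graph → u ≢ v* → sumOver (P.list u) P.f ≡ deg P.graph u →
                       sumOver (C.list (ι u)) C.f ≡ deg C.graph (ι u)
  private-degree-sum {u} u∈V u≢v* balanced = begin
    sumOver (C.list (ι u)) C.f                       ≡⟨ sumOver-list u∈V C.f ⟩
    sumOver (P.list u) (C.f ∘ κ)                     ≡⟨ sumOver-cong (P.list u) (λ x∈ →
      f-private (list⊆V P.isCover u∈V x∈) (private-label u∈V u≢v* x∈)) ⟩
    sumOver (P.list u) P.f                           ≡⟨ balanced ⟩
    deg P.graph u                                    ≡⟨ sumOver-vertices u∈V ⟨
    sumOver (image ι (V P.graph)) (μ C.graph (ι u))  ≡⟨ sum-support _ _ outside ⟨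
    deg C.graph (ι u)                                ∎
    where
    open ≡-Reasoning
    outside : ∀ w → w ∉ image ι (V P.graph) → μ C.graph (ι u) w ≡ 0
    outside w w∉ with μ C.graph (ι u) w ℕ.≟ 0
    ... | yes μ≡0 = μ≡0
    ... | no  μ≢0 = contradiction (neighbours u∈V u≢v* μ≢0) w∉

  module _ {τ : Fin C.n → Fin C.m} (τ∈X : IsSelector C.graph C.cover τ) where

    -- The list of `ι u` is the `κ`-image of the list of `u`, so each chosen colour has a preimage
    -- there; `v*` provides the default point.
    pull-back : ∃ λ (τ′ : Fin P.n → Fin P.m) →
                ∀ {u} → u ∈ V P.graph → τ′ u ∈ P.list u × κ (τ′ u) ≡ τ (ι u)
    pull-back = choose (v* , v*∈V) λ u∈V → Equivalence.to (lists u∈V _) (τ∈X (ι∈V u∈V))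

    τ′ : Fin P.n → Fin P.m
    τ′ = proj₁ pull-back

    τ′∈X : IsSelector P.graph P.cover τ′
    τ′∈X u∈V = proj₁ (proj₂ pull-back u∈V)

    κτ′ : ∀ {u} → u ∈ V P.graph → κ (τ′ u) ≡ τ (ι u)
    κτ′ u∈V = proj₂ (proj₂ pull-back u∈V)

    τ′∈V : ∀ {u} → u ∈ V P.graph → τ′ u ∈ V P.coverGraph
    τ′∈V u∈V = list⊆V P.isCover u∈V (τ′∈X u∈V)

    -- Colours of one piece keep their mutual multiplicities, the identified ones included, so
    -- carrying `W` into the merge changes no degree inside `W`.
    sumOver-obstruction : ∀ {W u} → W ⊆ V P.graph → u ∈ W →
      sumOver (image ι W) (λ w → μ C.coverGraph (τ (ι u)) (τ w)) ≡
      sumOver W (λ w → μ P.coverGraph (τ′ u) (τ′ w))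
    sumOver-obstruction {W} {u} W⊆V u∈W = trans
      (sumOver-image ι W (λ x∈ y∈ → ι-inj (W⊆V x∈) (W⊆V y∈)) _)
      (sumOver-cong W λ {w} w∈W → trans
        (cong₂ (μ C.coverGraph) (sym (κτ′ (W⊆V u∈W))) (sym (κτ′ (W⊆V w∈W))))
        (κ-mult (τ′∈V (W⊆V u∈W)) (τ′∈V (W⊆V w∈W))))

    private-f : ∀ {u} → u ∈ V P.graph → u ≢ v* → C.f (τ (ι u)) ≡ P.f (τ′ u)
    private-f u∈V u≢v* = trans (cong C.f (sym (κτ′ u∈V)))
      (f-private (τ′∈V u∈V) (private-label u∈V u≢v* (τ′∈X u∈V)))

    image⊆V : ∀ {W} → W ⊆ V P.graph → image ι W ⊆ V C.graph
    image⊆V {W} W⊆V w∈ with ∈-image⁻ ι W w∈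
    ... | u , u∈W , refl = ι∈V (W⊆V u∈W)

    private-f≤deg : (o : Obstruction 𝒞′ τ′) → let open Obstruction o in
      ∀ {u} → u ∈ W → u ≢ v* →
      C.f (τ (ι u)) ≤ sumOver (image ι W) (λ w → μ C.coverGraph (τ (ι u)) (τ w))
    private-f≤deg o u∈W u≢v* = subst₂ _≤_ (sym (private-f (W⊆V u∈W) u≢v*))
      (sym (sumOver-obstruction W⊆V u∈W)) (f≤deg u∈W)
      where open Obstruction o

    private-obstruction : (o : Obstruction 𝒞′ τ′) → v* ∉ Obstruction.W o → Obstruction 𝒞 τ
    private-obstruction o v*∉W = record
      { W        = image ι W
      ; W⊆V      = image⊆V W⊆V
      ; nonempty = _ , ∈-image⁺ ι (proj₂ nonempty)
      ; f≤deg    = f≤deg′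
      }
      where
      open Obstruction o
      f≤deg′ : ∀ {v} → v ∈ image ι W →
               C.f (τ v) ≤ sumOver (image ι W) (λ w → μ C.coverGraph (τ v) (τ w))
      f≤deg′ v∈ with ∈-image⁻ ι W v∈
      ... | u , u∈W , refl = private-f≤deg o u∈W λ { refl → v*∉W u∈W }

module _ {𝒞¹ 𝒞² 𝒞 : Configuration} (merge : IsMerge 𝒞¹ 𝒞² 𝒞) where
  open IsMerge merge
  open Configuration 𝒞
  private
    module C¹ = Configuration 𝒞¹
    module C² = Configuration 𝒞²
    module G-id = IsIdentification graph-id
    module H-id = IsIdentification cover-id

  ι¹v¹≡ι²v² : ι¹ v¹ ≡ ι² v²
  ι¹v¹≡ι²v² = Equivalence.from (G-id.identified v¹∈V v²∈V) (refl , refl)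

  piece¹ : Piece 𝒞¹ 𝒞
  piece¹ = record
    { v*         = v¹
    ; ι          = ι¹
    ; κ          = κ¹
    ; ι∈V        = λ u∈V → Equivalence.from (G-id.vertices _) (inj₁ (_ , u∈V , refl))
    ; ι-inj      = G-id.injective¹
    ; κ-inj      = H-id.injective¹
    ; ι-mult     = G-id.mult¹
    ; κ-mult     = H-id.mult¹
    ; lists      = lists¹
    ; f-private  = f¹
    ; neighbours = neighbours
    ; v*∈V       = v¹∈V
    }
    where
    neighbours : ∀ {u w} → u ∈ V C¹.graph → u ≢ v¹ → μ graph (ι¹ u) w ≢ 0 → w ∈ image ι¹ (V C¹.graph)
    neighbours {u} {w} u∈V u≢v¹ μ≢0
      with Equivalence.to (G-id.vertices w) (supported graph w (ι¹ u) (μ≢0 ∘ trans (symmetric graph _ _)))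
    ... | inj₁ (u′ , u′∈V , refl) = ∈-image⁺ ι¹ u′∈V
    ... | inj₂ (w′ , w′∈V , refl) with w′ ≟ v²
    ...   | yes refl = subst (_∈ image ι¹ (V C¹.graph)) ι¹v¹≡ι²v² (∈-image⁺ ι¹ v¹∈V)
    ...   | no w′≢v² = contradiction
      (G-id.mult-cross u∈V w′∈V (λ _ → u≢v¹ ∘ proj₁) (λ _ → w′≢v² ∘ proj₂)) μ≢0

  piece² : Piece 𝒞² 𝒞
  piece² = record
    { v*         = v²
    ; ι          = ι²
    ; κ          = κ²
    ; ι∈V        = λ u∈V → Equivalence.from (G-id.vertices _) (inj₂ (_ , u∈V , refl))
    ; ι-inj      = G-id.injective²
    ; κ-inj      = H-id.injective²
    ; ι-mult     = G-id.mult²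
    ; κ-mult     = H-id.mult²
    ; lists      = lists²
    ; f-private  = f²
    ; neighbours = neighbours
    ; v*∈V       = v²∈V
    }
    where
    neighbours : ∀ {u w} → u ∈ V C².graph → u ≢ v² → μ graph (ι² u) w ≢ 0 → w ∈ image ι² (V C².graph)
    neighbours {u} {w} u∈V u≢v² μ≢0
      with Equivalence.to (G-id.vertices w) (supported graph w (ι² u) (μ≢0 ∘ trans (symmetric graph _ _)))
    ... | inj₂ (u′ , u′∈V , refl) = ∈-image⁺ ι² u′∈V
    ... | inj₁ (w′ , w′∈V , refl) with w′ ≟ v¹
    ...   | yes refl = subst (_∈ image ι² (V C².graph)) (sym ι¹v¹≡ι²v²) (∈-image⁺ ι² v²∈V)
    ...   | no w′≢v¹ = contradiction (trans (symmetric graph _ _)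
      (G-id.mult-cross w′∈V u∈V (λ _ → w′≢v¹ ∘ proj₁) (λ _ → u≢v² ∘ proj₂))) μ≢0

  common-vertex : ∀ {W¹ W² v} → W¹ ⊆ V C¹.graph → W² ⊆ V C².graph →
                  v ∈ image ι¹ W¹ → v ∈ image ι² W² → v ≡ ι¹ v¹
  common-vertex {W¹} {W²} W¹⊆V W²⊆V v∈¹ v∈² with ∈-image⁻ ι¹ W¹ v∈¹ | ∈-image⁻ ι² W² v∈²
  ... | u , u∈W¹ , refl | w , w∈W² , eq =
    cong ι¹ (proj₁ (Equivalence.to (G-id.identified (W¹⊆V u∈W¹) (W²⊆V w∈W²)) (sym eq)))

  module _ (balanced¹ : Balanced 𝒞¹) (balanced² : Balanced 𝒞²) where
    private
      module B¹ = Balanced balanced¹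
      module B² = Balanced balanced²

    -- Both sides split into the contributions of the two pieces. On the left `π` matches the lists
    -- and `f` adds up; on the right the two vertex sets meet only in the identified vertex, which
    -- has no loop, so no edge is counted twice.
    merged-degree-sum* : sumOver (list (ι¹ v¹)) f ≡ deg graph (ι¹ v¹)
    merged-degree-sum* = begin
      sumOver (list (ι¹ v¹)) f                              ≡⟨ sumOver-list piece¹ v¹∈V f ⟩
      sumOver L¹ (f ∘ κ¹)                                   ≡⟨ sumOver-cong L¹ f* ⟩
      sumOver L¹ (λ x → C¹.f x + C².f (π x))                ≡⟨ sumOver-+ L¹ C¹.f (C².f ∘ π) ⟩
      sumOver L¹ C¹.f + sumOver L¹ (C².f ∘ π)               ≡⟨ cong (sumOver L¹ C¹.f +_)
        (sumOver-image π L¹ injective C².f) ⟨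
      sumOver L¹ C¹.f + sumOver (image π L¹) C².f           ≡⟨ cong (λ S → sumOver L¹ C¹.f + sumOver S C².f)
        (image-unique π λ y → mk⇔ surjective λ { (x , x∈ , refl) → maps-to x∈ }) ⟨
      sumOver L¹ C¹.f + sumOver (C².list v²) C².f           ≡⟨ cong₂ _+_ (B¹.degree-sum v¹∈V) (B².degree-sum v²∈V) ⟩
      deg C¹.graph v¹ + deg C².graph v²                     ≡⟨ cong₂ _+_ (sumOver-vertices piece¹ v¹∈V)
        (trans (cong (λ v → sumOver V² (μ graph v)) ι¹v¹≡ι²v²) (sumOver-vertices piece² v²∈V)) ⟨
      sumOver V¹ (μ graph (ι¹ v¹)) + sumOver V² (μ graph (ι¹ v¹)) ≡⟨ sumOver-∪ V¹ V² _ (λ v∈¹ v∈² →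
        trans (cong (μ graph (ι¹ v¹)) (common-vertex (λ p → p) (λ p → p) v∈¹ v∈²)) (loopless graph _)) ⟨
      sumOver (V¹ ∪ V²) (μ graph (ι¹ v¹))                   ≡⟨ cong (λ S → sumOver S (μ graph (ι¹ v¹))) V≡ ⟨
      sumOver (V graph) (μ graph (ι¹ v¹))                   ≡⟨ deg≡sumOver graph (ι¹ v¹) ⟨
      deg graph (ι¹ v¹)                                     ∎
      where
      open ≡-Reasoning
      open IsBijection bijection
      L¹ = C¹.list v¹
      V¹ = image ι¹ (V C¹.graph)
      V² = image ι² (V C².graph)
      V⊆ : V graph ⊆ V¹ ∪ V²
      V⊆ v∈ with Equivalence.to (G-id.vertices _) v∈
      ... | inj₁ (u , u∈ , refl) = p⊆p∪q V² (∈-image⁺ ι¹ u∈)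
      ... | inj₂ (w , w∈ , refl) = q⊆p∪q V¹ V² (∈-image⁺ ι² w∈)
      V⊇ : V¹ ∪ V² ⊆ V graph
      V⊇ v∈ with x∈p∪q⁻ V¹ V² v∈
      ... | inj₁ v∈¹ = Equivalence.from (G-id.vertices _) (inj₁ (∈-image⁻ ι¹ _ v∈¹))
      ... | inj₂ v∈² = Equivalence.from (G-id.vertices _) (inj₂ (∈-image⁻ ι² _ v∈²))
      V≡ : V graph ≡ V¹ ∪ V²
      V≡ = ⊆-antisym V⊆ V⊇

    merged-degree-sum : ∀ {v} → v ∈ V graph → sumOver (list v) f ≡ deg graph v
    merged-degree-sum v∈V with Equivalence.to (G-id.vertices _) v∈V
    ... | inj₁ (u , u∈V , refl) with u ≟ v¹
    ...   | yes refl = merged-degree-sum*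
    ...   | no u≢v¹  = private-degree-sum piece¹ u∈V u≢v¹ (B¹.degree-sum u∈V)
    merged-degree-sum v∈V | inj₂ (w , w∈V , refl) with w ≟ v²
    ...   | yes refl = subst (λ v → sumOver (list v) f ≡ deg graph v) ι¹v¹≡ι²v² merged-degree-sum*
    ...   | no w≢v²  = private-degree-sum piece² w∈V w≢v² (B².degree-sum w∈V)

    module _ {τ : Fin n → Fin m} (τ∈X : IsSelector graph cover τ) where
      private
        τ¹ = τ′ piece¹ τ∈X
        τ² = τ′ piece² τ∈X

      -- Both restrictions come from the single colour that `τ` picks at the identified vertex, and
      -- two colours have the same image in `H` only if `π` pairs them. This makes `f*` applicable
      -- to the selected colours.
      πτ¹≡τ² : π (τ¹ v¹) ≡ τ² v²
      πτ¹≡τ² = proj₂ (Equivalence.to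
        (H-id.identified (τ′∈V piece¹ τ∈X v¹∈V) (τ′∈V piece² τ∈X v²∈V))
        (trans (κτ′ piece¹ τ∈X v¹∈V) (trans (cong τ ι¹v¹≡ι²v²) (sym (κτ′ piece² τ∈X v²∈V)))))

      f-merged : f (τ (ι¹ v¹)) ≡ C¹.f (τ¹ v¹) + C².f (τ² v²)
      f-merged = begin
        f (τ (ι¹ v¹))                    ≡⟨ cong f (κτ′ piece¹ τ∈X v¹∈V) ⟨
        f (κ¹ (τ¹ v¹))                   ≡⟨ f* (τ′∈X piece¹ τ∈X v¹∈V) ⟩
        C¹.f (τ¹ v¹) + C².f (π (τ¹ v¹))  ≡⟨ cong (λ y → C¹.f (τ¹ v¹) + C².f y) πτ¹≡τ² ⟩
        C¹.f (τ¹ v¹) + C².f (τ² v²)      ∎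
        where open ≡-Reasoning

      union-obstruction : (o¹ : Obstruction 𝒞¹ τ¹) (o² : Obstruction 𝒞² τ²) →
                          v¹ ∈ Obstruction.W o¹ → v² ∈ Obstruction.W o² → Obstruction 𝒞 τ
      union-obstruction o¹ o² v¹∈W v²∈W = record
        { W        = I¹ ∪ I²
        ; W⊆V      = W⊆V
        ; nonempty = _ , p⊆p∪q I² (∈-image⁺ ι¹ v¹∈W)
        ; f≤deg    = f≤deg
        }
        where
        module O¹ = Obstruction o¹
        module O² = Obstruction o²
        I¹ = image ι¹ O¹.W
        I² = image ι² O².W
        row : Fin n → Fin n → ℕ
        row v w = μ coverGraph (τ v) (τ w)
        W⊆V : I¹ ∪ I² ⊆ V graph
        W⊆V v∈ with x∈p∪q⁻ I¹ I² v∈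
        ... | inj₁ v∈¹ = image⊆V piece¹ τ∈X O¹.W⊆V v∈¹
        ... | inj₂ v∈² = image⊆V piece² τ∈X O².W⊆V v∈²
        -- The degrees add because the two images share only `ι¹ v¹`, whose entry in its own row is
        -- a loop.
        f≤deg* : f (τ (ι¹ v¹)) ≤ sumOver (I¹ ∪ I²) (row (ι¹ v¹))
        f≤deg* = begin
          f (τ (ι¹ v¹))                                            ≡⟨ f-merged ⟩
          C¹.f (τ¹ v¹) + C².f (τ² v²)                              ≤⟨ +-mono-≤ (O¹.f≤deg v¹∈W) (O².f≤deg v²∈W) ⟩
          sumOver O¹.W (λ w → μ C¹.coverGraph (τ¹ v¹) (τ¹ w)) +
          sumOver O².W (λ w → μ C².coverGraph (τ² v²) (τ² w))
            ≡⟨ cong₂ _+_ (sumOver-obstruction piece¹ τ∈X O¹.W⊆V v¹∈W)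
                         (sumOver-obstruction piece² τ∈X O².W⊆V v²∈W) ⟨
          sumOver I¹ (row (ι¹ v¹)) + sumOver I² (row (ι² v²))
            ≡⟨ cong (λ v → sumOver I¹ (row (ι¹ v¹)) + sumOver I² (row v)) ι¹v¹≡ι²v² ⟨
          sumOver I¹ (row (ι¹ v¹)) + sumOver I² (row (ι¹ v¹))
            ≡⟨ sumOver-∪ I¹ I² _ (λ v∈¹ v∈² → trans
                 (cong (row (ι¹ v¹)) (common-vertex O¹.W⊆V O².W⊆V v∈¹ v∈²)) (loopless coverGraph _)) ⟨
          sumOver (I¹ ∪ I²) (row (ι¹ v¹))                          ∎
          where open ≤-Reasoning
        f≤deg : ∀ {v} → v ∈ I¹ ∪ I² → f (τ v) ≤ sumOver (I¹ ∪ I²) (row v)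
        f≤deg v∈ with x∈p∪q⁻ I¹ I² v∈
        ... | inj₁ v∈¹ with ∈-image⁻ ι¹ O¹.W v∈¹
        ...   | u , u∈W , refl with u ≟ v¹
        ...     | yes refl = f≤deg*
        -- A private vertex already has enough degree within its own image; enlarging the set cannot
        -- lower it.
        ...     | no u≢v¹  = ≤-trans (private-f≤deg piece¹ τ∈X o¹ u∈W u≢v¹) (sumOver-⊆ {S = I¹} (row (ι¹ u)) (p⊆p∪q I²))
        f≤deg v∈ | inj₂ v∈² with ∈-image⁻ ι² O².W v∈²
        ...   | u , u∈W , refl with u ≟ v²
        ...     | yes refl = subst (λ v → f (τ v) ≤ sumOver (I¹ ∪ I²) (row v)) ι¹v¹≡ι²v² f≤deg*
        ...     | no u≢v²  = ≤-trans (private-f≤deg piece² τ∈X o² u∈W u≢v²) (sumOver-⊆ (row (ι² u)) (q⊆p∪q I¹ I²))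

      merged-obstruction : Obstruction 𝒞 τ
      merged-obstruction
        with B¹.obstruction τ¹ (τ′∈X piece¹ τ∈X) | B².obstruction τ² (τ′∈X piece² τ∈X)
      ... | o¹ | o² with v¹ ∈? Obstruction.W o¹ | v² ∈? Obstruction.W o²
      ... | yes v¹∈W | yes v²∈W = union-obstruction o¹ o² v¹∈W v²∈W
      ... | no  v¹∉W | _        = private-obstruction piece¹ τ∈X o¹ v¹∉W
      ... | yes _    | no v²∉W  = private-obstruction piece² τ∈X o² v²∉W

    merge-balanced : Balanced 𝒞
    merge-balanced = record
      { nonempty    = ι¹ v¹ , Piece.ι∈V piece¹ v¹∈V
      ; degree-sum  = merged-degree-sum
      ; obstruction = λ τ τ∈X → merged-obstruction τ∈X
      }

-- Inflations of G-covers

induced-μ : ∀ {n} (G : Graph n) {W : Subset n} {u v} → u ∈ W → v ∈ W → μ (induced G W) u v ≡ μ G u v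
induced-μ G u∈W v∈W rewrite []=⇒lookup u∈W | []=⇒lookup v∈W = refl

-- Extends `between` to the diagonal: a block is independent and the graph before inflation has no
-- loops, so both sides are zero when `x` and `y` coincide.
inflation-μ : ∀ {s n m m̃} {G : Graph n} {C : CoverData n m} {C̃ : CoverData n m̃}
              (inflation : IsInflation s G C C̃) → let open IsInflation inflation in
              ∀ {x y a b} → x ∈ V (H C) → y ∈ V (H C) → a ∈ B x → b ∈ B y →
              μ (H C̃) a b * s ≡ μ (H C) x y
inflation-μ {s} {C = C} inflation {x} {y} x∈V y∈V a∈B b∈B with x ≟ y
... | yes refl = trans (cong (_* s) (IsInflation.independent inflation x∈V a∈B b∈B)) (sym (loopless (H C) x))
... | no  x≢y  = IsInflation.between inflation x∈V y∈V x≢y a∈B b∈B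

-- C / U is the s-inflation of a G-cover; for u ≡ v both sides of mult vanish.
record BlowUp {n m} (G : Graph n) (C : CoverData n m) (U : Subset m) : Set where
  field
    s    : ℕ
    s≥1  : 1 ≤ s
    size : ∀ {v} → v ∈ V G → ∣ X C v ∩ U ∣ ≡ s
    mult : ∀ {u v a b} → u ∈ V G → v ∈ V G → a ∈ X C u → b ∈ X C v → a ∈ U → b ∈ U →
           μ (H C) a b * s ≡ μ G u v

-- The lists of a `G`-cover are singletons, so `X C v ∩ U` is precisely the block replacing the one
-- vertex over `v`.
blowUp : ∀ {n m} {G : Graph n} {C : CoverData n m} {U : Subset m} →
         IsInflationOfGCover G (C / U) → BlowUp G C U
blowUp {G = G} {C} {U} (s , _ , C₀ , gCover , inflation) = record
  { s = s ; s≥1 = Inf.s≥1 ; size = size ; mult = mult }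
  where
  module Inf = IsInflation inflation
  module Cov = IsGCover gCover
  x∈X : ∀ {v} → v ∈ V G → Cov.x v ∈ X C₀ v
  x∈X v∈V = subst (_ ∈_) (sym (Cov.singleton v∈V)) (x∈⁅x⁆ _)
  x∈V : ∀ {v} → v ∈ V G → Cov.x v ∈ V (H C₀)
  x∈V v∈V = list⊆V Cov.isCover v∈V (x∈X v∈V)
  ∈B : ∀ {v} → v ∈ V G → X C v ∩ U ⊆ Inf.B (Cov.x v)
  ∈B v∈V a∈ with Equivalence.to (Inf.lists v∈V _) a∈
  ... | y , y∈X , a∈B = subst (λ z → _ ∈ Inf.B z) (x∈⁅y⁆⇒x≡y _ (subst (y ∈_) (Cov.singleton v∈V) y∈X)) a∈B
  B⊆ : ∀ {v} → v ∈ V G → Inf.B (Cov.x v) ⊆ X C v ∩ U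
  B⊆ v∈V a∈B = Equivalence.from (Inf.lists v∈V _) (_ , x∈X v∈V , a∈B)
  size : ∀ {v} → v ∈ V G → ∣ X C v ∩ U ∣ ≡ s
  size v∈V = trans (cong ∣_∣ (⊆-antisym (∈B v∈V) (B⊆ v∈V))) (Inf.size (x∈V v∈V))
  mult : ∀ {u v a b} → u ∈ V G → v ∈ V G → a ∈ X C u → b ∈ X C v → a ∈ U → b ∈ U →
         μ (H C) a b * s ≡ μ G u v
  mult {u} {v} u∈V v∈V a∈X b∈X a∈U b∈U = trans
    (cong (_* s) (sym (induced-μ (H C) a∈U b∈U)))
    (trans (inflation-μ inflation (x∈V u∈V) (x∈V v∈V) (∈B u∈V (x∈p∩q⁺ (a∈X , a∈U))) (∈B v∈V (x∈p∩q⁺ (b∈X , b∈U))))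
           x-mult)
    where
    x-mult : μ (H C₀) (Cov.x u) (Cov.x v) ≡ μ G u v
    x-mult with u ≟ v
    ... | yes refl = trans (loopless (H C₀) _) (sym (loopless G u))
    ... | no  u≢v  = Cov.mult u∈V v∈V u≢v

module _ {𝒞 : Configuration} {U : Subset (Configuration.m 𝒞)}
         (blow-up : BlowUp (Configuration.graph 𝒞) (Configuration.cover 𝒞) U) where
  open Configuration 𝒞
  open BlowUp blow-up

  sumOver-blowUp : ∀ {v d} → v ∈ V graph → (∀ {x} → x ∈ list v → x ∈ U → f x * ∣ list v ∩ U ∣ ≡ d) →
                   sumOver (list v ∩ U) f ≡ d
  sumOver-blowUp {v} {d} v∈V f-inside = sumOver-quotients (list v ∩ U) f d
    (≤-trans s≥1 (≤-reflexive (sym (size v∈V))))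
    λ x∈ → let x∈X , x∈U = x∈p∩q⁻ (list v) U x∈ in f-inside x∈X x∈U

  -- Scaling by `s`, the common size of the lists within `U`, turns multiplicities of `H` into those
  -- of `G`. What remains to be checked is an inequality about degrees in `G[W]`.
  class-obstruction : ∀ {τ} (W : Subset n) → IsSelector graph cover τ → W ⊆ V graph → Nonempty W →
                      (∀ {v} → v ∈ W → τ v ∈ U) →
                      (∀ {v} → v ∈ W → f (τ v) * ∣ list v ∩ U ∣ ≤ sumOver W (μ graph v)) →
                      Obstruction 𝒞 τ
  class-obstruction {τ} W τ∈X W⊆V nonempty τ∈U f≤ = record
    { W = W ; W⊆V = W⊆V ; nonempty = nonempty ; f≤deg = f≤deg }
    where
    f≤deg : ∀ {v} → v ∈ W → f (τ v) ≤ sumOver W (λ u → μ coverGraph (τ v) (τ u))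
    f≤deg {v} v∈W = *-cancelʳ-≤ _ _ s {{>-nonZero s≥1}} (begin
      f (τ v) * s                                         ≡⟨ cong (f (τ v) *_) (size (W⊆V v∈W)) ⟨
      f (τ v) * ∣ list v ∩ U ∣                            ≤⟨ f≤ v∈W ⟩
      sumOver W (μ graph v)                               ≡⟨ sumOver-cong W (λ u∈W →
        mult (W⊆V v∈W) (W⊆V u∈W) (τ∈X (W⊆V v∈W)) (τ∈X (W⊆V u∈W)) (τ∈U v∈W) (τ∈U u∈W)) ⟨
      sumOver W (λ u → μ coverGraph (τ v) (τ u) * s)      ≡⟨ sumOver-*ʳ W _ s ⟨
      sumOver W (λ u → μ coverGraph (τ v) (τ u)) * s      ∎)
      where open ≤-Reasoning

-- M-configurations and K-configurations.

M-balanced : ∀ {𝒞} → IsMConfiguration 𝒞 → Balanced 𝒞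
M-balanced {𝒞} isM = record
  { nonempty    = V-nonempty
  ; degree-sum  = λ {v} v∈V → trans
      (sumOver-support f (p∩q⊆p (list v) U)
        (λ x∈X x∉ → f-outside v∈V x∈X (λ x∈U → x∉ (x∈p∩q⁺ (x∈X , x∈U)))))
      (sumOver-blowUp {𝒞} (blowUp inflation) v∈V (f-inside v∈V))
  ; obstruction = λ τ τ∈X → obstruction-if-positive {𝒞} λ f≢0 →
      let τ∈U : ∀ {v} → v ∈ V graph → τ v ∈ U
          τ∈U {v} v∈V = decidable-stable (τ v ∈? U) λ τv∉U → f≢0 v∈V (f-outside v∈V (τ∈X v∈V) τv∉U)
      in class-obstruction {𝒞} (blowUp inflation) (V graph) τ∈X (λ v∈V → v∈V) V-nonempty τ∈U
           λ v∈V → ≤-reflexive (trans (f-inside v∈V (τ∈X v∈V) (τ∈U v∈V)) (deg≡sumOver graph _))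
  }
  where
  open Configuration 𝒞
  open IsMConfiguration isM
  V-nonempty = proj₁ (proj₁ block)

-- Adding t on both sides avoids the truncated subtraction ∣ W ∣ ∸ 1.
sumOver-complete : ∀ {t k n} {G : Graph n} → IsMultiComplete t k G → ∀ {W v} → W ⊆ V G → v ∈ W →
                   sumOver W (μ G v) + t ≡ ∣ W ∣ * t
sumOver-complete {t} {G = G} complete {W} {v} W⊆V v∈W = begin
  sumOver W (μ G v) + t                                     ≡⟨ cong (sumOver W (μ G v) +_) diagonal ⟨
  sumOver W (μ G v) + sumOver W (restrict ⁅ v ⁆ (λ _ → t))  ≡⟨ sumOver-+ W (μ G v) _ ⟨
  sumOver W (λ u → μ G v u + restrict ⁅ v ⁆ (λ _ → t) u)    ≡⟨ sumOver-cong W entry ⟩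
  sumOver W (λ _ → t)                                       ≡⟨ sumOver-const W t ⟩
  ∣ W ∣ * t                                                 ∎
  where
  open ≡-Reasoning
  diagonal : sumOver W (restrict ⁅ v ⁆ (λ _ → t)) ≡ t
  diagonal = trans
    (sumOver-support {S = ⁅ v ⁆} (restrict ⁅ v ⁆ (λ _ → t))
      (λ u∈ → subst (_∈ W) (sym (x∈⁅y⁆⇒x≡y v u∈)) v∈W) (λ _ → if-∉))
    (trans (sumOver-⁅⁆ v (restrict ⁅ v ⁆ (λ _ → t))) (if-∈ (x∈⁅x⁆ v)))
  entry : ∀ {u} → u ∈ W → μ G v u + restrict ⁅ v ⁆ (λ _ → t) u ≡ t
  entry {u} u∈W with u ≟ v
  ... | yes refl = cong₂ _+_ (loopless G v) (if-∈ (x∈⁅x⁆ v))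
  ... | no  u≢v  = trans
    (cong₂ _+_ (IsMultiComplete.mult complete (W⊆V v∈W) (W⊆V u∈W) (u≢v ∘ sym)) (if-∉ (x≢y⇒x∉⁅y⁆ u≢v)))
    (+-identityʳ t)

K-balanced : ∀ {𝒞} → IsKConfiguration 𝒞 → Balanced 𝒞
K-balanced {𝒞} isK = record
  { nonempty    = ∣S∣≥1⇒nonempty (V graph) (≤-trans k≥1 (≤-reflexive (sym order)))
  ; degree-sum  = degree-sum
  ; obstruction = λ τ τ∈X → obstruction-if-positive {𝒞} (monochromatic τ∈X)
  }
  where
  open Configuration 𝒞
  open IsKConfiguration isK
  open IsMultiComplete complete

  degree-sum : ∀ {v} → v ∈ V graph → sumOver (list v) f ≡ deg graph v
  degree-sum {v} v∈V = +-cancelʳ-≡ t _ _ (begin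
    sumOver (list v) f + t                     ≡⟨ cong (_+ t) (sumOver-partition (list v) U f disjoint (f-outside v∈V)) ⟩
    sum (λ i → sumOver (list v ∩ U i) f) + t   ≡⟨ cong (_+ t) (sum-cong-≗ λ i →
      sumOver-blowUp {𝒞} (blowUp (inflation i)) v∈V (λ x∈X → f-inside v∈V x∈X i)) ⟩
    sum (λ i → t * ns i) + t                   ≡⟨ cong (_+ t) (*-distribˡ-sum t ns) ⟨
    t * sum ns + t                             ≡⟨ cong (λ z → t * z + t) sum-ns ⟩
    t * (k ∸ 1) + t                            ≡⟨ +-comm (t * (k ∸ 1)) t ⟩
    t + t * (k ∸ 1)                            ≡⟨ *-suc t (k ∸ 1) ⟨
    t * suc (k ∸ 1)                            ≡⟨ cong (t *_) (m+[n∸m]≡n k≥1) ⟩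
    t * k                                      ≡⟨ *-comm t k ⟩
    k * t                                      ≡⟨ cong (_* t) order ⟨
    ∣ V graph ∣ * t                            ≡⟨ sumOver-complete complete (λ p → p) v∈V ⟨
    sumOver (V graph) (μ graph v) + t          ≡⟨ cong (_+ t) (deg≡sumOver graph v) ⟨
    deg graph v + t                            ∎)
    where open ≡-Reasoning

  monochromatic : ∀ {τ} → IsSelector graph cover τ → (∀ {v} → v ∈ V graph → f (τ v) ≢ 0) → Obstruction 𝒞 τ
  monochromatic {τ} τ∈X f≢0 = obstruct (pigeonhole-cover (V graph) W ns covered sum-ns<)
    where
    W? : ∀ i v → Dec (v ∈ V graph × τ v ∈ U i)
    W? i v = v ∈? V graph ×-dec τ v ∈? U i
    W : Fin p → Subset n
    W i = comprehension (W? i)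
    covered : ∀ {v} → v ∈ V graph → ∃[ i ] v ∈ W i
    covered {v} v∈V with any? (λ i → τ v ∈? U i)
    ... | yes (i , τv∈U) = i , ∈-comprehension⁺ (W? i) (v∈V , τv∈U)
    ... | no  none       = contradiction (f-outside v∈V (τ∈X v∈V) λ i τv∈U → none (i , τv∈U)) (f≢0 v∈V)
    -- The `ns i` add up to one less than the number of vertices, which is just enough for the
    -- pigeonhole.
    sum-ns< : sum ns < ∣ V graph ∣
    sum-ns< = ≤-reflexive (trans (cong suc sum-ns) (trans (m+[n∸m]≡n k≥1) (sym order)))
    obstruct : ∃[ i ] ns i < ∣ W i ∣ → Obstruction 𝒞 τ
    obstruct (i , ns<) = class-obstruction {𝒞} (blowUp (inflation i)) (W i) τ∈X W⊆V
      (∣S∣≥1⇒nonempty (W i) (≤-trans (s≤s z≤n) ns<)) (proj₂ ∘ ∈-comprehension⁻ (W? i)) f≤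
      where
      W⊆V : W i ⊆ V graph
      W⊆V = proj₁ ∘ ∈-comprehension⁻ (W? i)
      f≤ : ∀ {v} → v ∈ W i → f (τ v) * ∣ list v ∩ U i ∣ ≤ sumOver (W i) (μ graph v)
      -- The degree within the class is `t` times `∣ W i ∣` minus one, and the class has at least
      -- `ns i` plus one vertices; the added `t` accounts for the missing diagonal entry on both
      -- sides.
      f≤ {v} v∈W = +-cancelʳ-≤ t _ _ (begin
        f (τ v) * ∣ list v ∩ U i ∣ + t    ≡⟨ cong (_+ t) (f-inside (W⊆V v∈W) (τ∈X (W⊆V v∈W)) i
                                               (proj₂ (∈-comprehension⁻ (W? i) v∈W))) ⟩
        t * ns i + t                      ≡⟨ +-comm (t * ns i) t ⟩
        t + t * ns i                      ≡⟨ *-suc t (ns i) ⟨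
        t * suc (ns i)                    ≤⟨ *-monoʳ-≤ t ns< ⟩
        t * ∣ W i ∣                       ≡⟨ *-comm t ∣ W i ∣ ⟩
        ∣ W i ∣ * t                       ≡⟨ sumOver-complete complete W⊆V v∈W ⟨
        sumOver (W i) (μ graph v) + t     ∎)
        where open ≤-Reasoning

-- Multicycles

-- Agrees by unfolding with the local relation behind `CyclicallyAdjacent`, so `inj₁` and `inj₂` of
-- it are proofs of adjacency.
Successor : ∀ {n} → Fin n → Fin n → Set
Successor {n} i j = _%_ (suc (toℕ i)) n {{nonZeroIndex i}} ≡ toℕ j

successor-suc : ∀ {n} {i j : Fin n} → suc (toℕ i) ≡ toℕ j → Successor i j
successor-suc {suc n} {i} {j} eq = trans (cong (_% suc n) eq) (m<n⇒m%n≡m (toℕ<n j))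

successor-wrap : ∀ {n} {i j : Fin n} → suc (toℕ i) ≡ n → toℕ j ≡ 0 → Successor i j
successor-wrap {suc n} eq j≡0 = trans (cong (_% suc n) eq) (trans (n%n≡0 (suc n)) (sym j≡0))

successor-cases : ∀ {n} {i j : Fin n} → Successor i j →
                  suc (toℕ i) ≡ toℕ j ⊎ (suc (toℕ i) ≡ n × toℕ j ≡ 0)
successor-cases {suc n} {i} {j} eq with m≤n⇒m<n∨m≡n (toℕ<n i)
... | inj₁ i<n = inj₁ (trans (sym (m<n⇒m%n≡m i<n)) eq)
... | inj₂ i≡n = inj₂ (i≡n , trans (sym eq) (trans (cong (_% suc n) i≡n) (n%n≡0 (suc n))))

successor-functional : ∀ {n} {i j j′ : Fin n} → Successor i j → Successor i j′ → j ≡ j′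
successor-functional p q = toℕ-injective (trans (sym p) q)

successor-injective : ∀ {n} {i i′ j : Fin n} → Successor i j → Successor i′ j → i ≡ i′
successor-injective p q with successor-cases p | successor-cases q
... | inj₁ e       | inj₁ e′       = toℕ-injective (ℕ.suc-injective (trans e (sym e′)))
... | inj₂ (e , _) | inj₂ (e′ , _) = toℕ-injective (ℕ.suc-injective (trans e (sym e′)))
... | inj₁ e       | inj₂ (_ , j≡0) = contradiction (trans e j≡0) λ ()
... | inj₂ (_ , j≡0) | inj₁ e      = contradiction (trans e j≡0) λ ()

-- Two steps forward lead back to the start only on a cycle of length at most two. This keeps the
-- two neighbours of a vertex apart in `cycle-degree`.
successor-asymmetric : ∀ {n} {i j : Fin n} → 3 ≤ n → Successor i j → ¬ Successor j i
successor-asymmetric {n} n≥3 p q with successor-cases p | successor-cases q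
... | inj₁ e         | inj₁ e′         = m≢1+m+n _ {1} (trans (sym e′) (trans (cong suc (sym e)) (cong suc (+-comm 1 _))))
... | inj₁ e         | inj₂ (e′ , i≡0) = <⇒≱ n≥3 (≤-reflexive (trans (sym e′) (cong suc (trans (sym e) (cong suc i≡0)))))
... | inj₂ (e , j≡0) | inj₁ e′         = <⇒≱ n≥3 (≤-reflexive (trans (sym e) (cong suc (trans (sym e′) (cong suc j≡0)))))
... | inj₂ (e , j≡0) | inj₂ (e′ , i≡0) = <⇒≱ n≥3 (≤-trans (≤-reflexive (trans (sym e) (cong suc i≡0))) (s≤s z≤n))

successor : ∀ {n} (i : Fin n) → ∃ (Successor i)
successor {suc n} i = fromℕ< (m%n<n (suc (toℕ i)) (suc n)) , sym (toℕ-fromℕ< _)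

predecessor : ∀ {n} (j : Fin n) → ∃[ i ] Successor i j
predecessor {suc n} zero    = fromℕ n , successor-wrap {j = zero} (cong suc (toℕ-fromℕ n)) refl
predecessor {suc n} (suc j) = inject₁ j , successor-suc {j = suc j} (cong suc (toℕ-inject₁ j))

-- Read along the enumeration `c`, the row of `c i` is supported on the next and the previous index;
-- they differ because `k` is at least three, and each contributes `t`.
cycle-degree : ∀ {t k n} {G : Graph n} {c : Fin k → Fin n} → 3 ≤ k → IsMultiCycle t k G c →
               ∀ {v} → v ∈ V G → deg G v ≡ 2 * t
cycle-degree {t} {k} {n} {G} {c} k≥3 cycle v∈V with Equivalence.to (IsMultiCycle.vertices cycle _) v∈V
... | i , refl = begin
  deg G (c i)                                  ≡⟨ deg≡sumOver G (c i) ⟩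
  sumOver (V G) (μ G (c i))                    ≡⟨ cong (λ S → sumOver S (μ G (c i))) (image-unique c λ v →
    mk⇔ (λ v∈ → let j , eq = Equivalence.to (vertices v) v∈ in j , ∈⊤ , eq)
        (λ { (j , _ , eq) → Equivalence.from (vertices v) (j , eq) })) ⟩
  sumOver (image c ⊤) (μ G (c i))              ≡⟨ sumOver-image c ⊤ (λ _ _ → injective) _ ⟩
  sumOver ⊤ row                                ≡⟨ sumOver-support row ⊆⊤ (λ {j} _ → outside j) ⟩
  sumOver (⁅ next ⁆ ∪ ⁅ prev ⁆) row            ≡⟨ sumOver-∪ ⁅ next ⁆ ⁅ prev ⁆ row (λ j∈ j∈′ → contradiction
    (trans (sym (x∈⁅y⁆⇒x≡y next j∈)) (x∈⁅y⁆⇒x≡y prev j∈′)) next≢prev) ⟩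
  sumOver ⁅ next ⁆ row + sumOver ⁅ prev ⁆ row  ≡⟨ cong₂ _+_ (sumOver-⁅⁆ next row) (sumOver-⁅⁆ prev row) ⟩
  row next + row prev                          ≡⟨ cong₂ _+_ (adjacent i next (inj₁ i→next))
                                                            (adjacent i prev (inj₂ prev→i)) ⟩
  t + t                                        ≡⟨ cong (t +_) (+-identityʳ t) ⟨
  2 * t                                        ∎
  where
  open ≡-Reasoning
  open IsMultiCycle cycle
  next = proj₁ (successor i)
  prev = proj₁ (predecessor i)
  i→next : Successor i next
  i→next = proj₂ (successor i)
  prev→i : Successor prev i
  prev→i = proj₂ (predecessor i)
  row : Fin k → ℕ
  row j = μ G (c i) (c j)
  next≢prev : next ≢ prev
  next≢prev eq = successor-asymmetric k≥3 i→next (subst (λ j → Successor j i) (sym eq) prev→i)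
  outside : ∀ j → j ∉ ⁅ next ⁆ ∪ ⁅ prev ⁆ → row j ≡ 0
  outside j j∉ = nonadjacent i j λ
    { (inj₁ i→j) → j∉ (p⊆p∪q ⁅ prev ⁆ (subst (_∈ ⁅ next ⁆) (successor-functional i→next i→j) (x∈⁅x⁆ next)))
    ; (inj₂ j→i) → j∉ (q⊆p∪q ⁅ next ⁆ ⁅ prev ⁆ (subst (_∈ ⁅ prev ⁆) (successor-injective prev→i j→i) (x∈⁅x⁆ prev)))
    }

-- Alternating colours along a path, and C-configurations.

flip : ℕ → Bool → Bool
flip zero    b = b
flip (suc k) b = flip k (not b)

-- Compares the first colour with the start of the alternation found on the remaining path: equal
-- colours give a repetition, different ones prolong the alternation by one change. The predicate
-- depends on the index so that it can stand for a set `U b` as well as for the blocks of a layer.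
repeat-or-alternate : ∀ k {P : Bool → Fin (suc k) → Set} → (∀ i → ∃[ b ] P b i) →
  (∃[ i ] ∃[ b ] P b (inject₁ i) × P b (suc i)) ⊎ (∃[ b ] P b zero × P (flip k b) (fromℕ k))
repeat-or-alternate zero    colour = inj₂ (proj₁ (colour zero) , proj₂ (colour zero) , proj₂ (colour zero))
repeat-or-alternate (suc k) {P} colour with colour zero | repeat-or-alternate k {λ b i → P b (suc i)} (colour ∘ suc)
... | b , pb | inj₁ (i , rest)     = inj₁ (suc i , rest)
... | b , pb | inj₂ (b′ , p₁ , pₖ) with b ≟ᵇ b′
...   | yes refl = inj₁ (zero , b , pb , p₁)
...   | no  b≢b′ = inj₂ (b , pb , subst (λ z → P (flip k z) (fromℕ (suc k))) (¬-not (b≢b′ ∘ sym)) pₖ)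

2∤1 : 2 ∤ 1
2∤1 2∣1 with ∣1⇒≡1 2∣1
... | ()

-- A path on `suc k` vertices has `k` colour changes, so an odd number of vertices means an even
-- number of changes. Removing two changes at a time preserves the parity.
flip-odd : ∀ k b → 2 ∤ suc k → flip k b ≡ b
flip-odd zero          b odd = refl
flip-odd (suc zero)    b odd = contradiction ∣-refl odd
flip-odd (suc (suc k)) b odd = trans (flip-odd k (not (not b)) (odd ∘ ∣m∣n⇒∣m+n ∣-refl)) (not-involutive b)

flip-even : ∀ k b → 2 ∣ suc k → flip k b ≡ not b
flip-even zero          b even = contradiction even 2∤1
flip-even (suc zero)    b even = refl
flip-even (suc (suc k)) b even = trans (flip-even k (not (not b)) (∣m+n∣m⇒∣n even ∣-refl)) (not-involutive (not b))

odd-C-balanced : ∀ {𝒞} → IsOddCConfiguration 𝒞 → Balanced 𝒞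
odd-C-balanced {𝒞} record { k = zero ; k≥3 = () }
odd-C-balanced {𝒞} isC@record { k = suc k′ } = record
  { nonempty    = c zero , c∈V zero
  ; degree-sum  = degree-sum
  ; obstruction = λ τ τ∈X → obstruction-if-positive {𝒞} (monochromatic τ∈X)
  }
  where
  open Configuration 𝒞
  open IsOddCConfiguration isC hiding (k)
  open IsMultiCycle cycle using (vertices; adjacent)
  c∈V : ∀ i → c i ∈ V graph
  c∈V i = Equivalence.from (vertices (c i)) (i , refl)

  degree-sum : ∀ {v} → v ∈ V graph → sumOver (list v) f ≡ deg graph v
  degree-sum {v} v∈V = begin
    sumOver (list v) f                                   ≡⟨ sumOver-support f ⊆L outside ⟩
    sumOver (L₁ ∪ L₂) f                                  ≡⟨ sumOver-∪ L₁ L₂ f (λ x∈₁ x∈₂ → contradiction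
      (_ , x∈p∩q⁺ (p∩q⊆q (list v) U₁ x∈₁ , p∩q⊆q (list v) U₂ x∈₂)) disjoint) ⟩
    sumOver L₁ f + sumOver L₂ f                          ≡⟨ cong₂ _+_
      (sumOver-blowUp {𝒞} (blowUp inflation₁) v∈V (f-inside₁ v∈V))
      (sumOver-blowUp {𝒞} (blowUp inflation₂) v∈V (f-inside₂ v∈V)) ⟩
    t + t                                                ≡⟨ cong (t +_) (+-identityʳ t) ⟨
    2 * t                                                ≡⟨ cycle-degree k≥3 cycle v∈V ⟨
    deg graph v                                          ∎
    where
    open ≡-Reasoning
    L₁ = list v ∩ U₁
    L₂ = list v ∩ U₂
    ⊆L : L₁ ∪ L₂ ⊆ list v
    ⊆L x∈ = [ p∩q⊆p (list v) U₁ , p∩q⊆p (list v) U₂ ]′ (x∈p∪q⁻ L₁ L₂ x∈)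
    outside : ∀ {x} → x ∈ list v → x ∉ L₁ ∪ L₂ → f x ≡ 0
    outside x∈ x∉ = f-outside v∈V x∈
      (λ x∈U → x∉ (p⊆p∪q L₂ (x∈p∩q⁺ (x∈ , x∈U)))) (λ x∈U → x∉ (q⊆p∪q L₁ L₂ (x∈p∩q⁺ (x∈ , x∈U))))

  U : Bool → Subset m
  U b = if b then U₁ else U₂

  inflated : ∀ b → BlowUp graph cover (U b)
  inflated true  = blowUp inflation₁
  inflated false = blowUp inflation₂

  f-inside : ∀ b {v x} → v ∈ V graph → x ∈ list v → x ∈ U b → f x * ∣ list v ∩ U b ∣ ≡ t
  f-inside true  = f-inside₁
  f-inside false = f-inside₂

  monochromatic : ∀ {τ} → IsSelector graph cover τ → (∀ {v} → v ∈ V graph → f (τ v) ≢ 0) → Obstruction 𝒞 τ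
  monochromatic {τ} τ∈X f≢0 = obstruct (repeat-or-alternate k′ colour)
    where
    colour : ∀ i → ∃[ b ] τ (c i) ∈ U b
    colour i with τ (c i) ∈? U₁ | τ (c i) ∈? U₂
    ... | yes ∈U₁ | _       = true , ∈U₁
    ... | no  _   | yes ∈U₂ = false , ∈U₂
    ... | no  ∉U₁ | no  ∉U₂ = contradiction (f-outside (c∈V i) (τ∈X (c∈V i)) ∉U₁ ∉U₂) (f≢0 (c∈V i))

    edge : ∀ {i j} b → Successor i j → τ (c i) ∈ U b → τ (c j) ∈ U b → Obstruction 𝒞 τ
    edge {i} {j} b i→j i∈ j∈ = edge-obstruction {𝒞} (c∈V i) (c∈V j) (f≤μ i∈) (f≤μ j∈)
      where
      open BlowUp (inflated b)
      f≤μ : ∀ {l} → τ (c l) ∈ U b → f (τ (c l)) ≤ μ coverGraph (τ (c i)) (τ (c j))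
      f≤μ {l} l∈ = *-cancelʳ-≤ _ _ s {{>-nonZero s≥1}} (≤-reflexive (begin
        f (τ (c l)) * s                             ≡⟨ cong (f (τ (c l)) *_) (size (c∈V l)) ⟨
        f (τ (c l)) * ∣ list (c l) ∩ U b ∣          ≡⟨ f-inside b (c∈V l) (τ∈X (c∈V l)) l∈ ⟩
        t                                           ≡⟨ adjacent i j (inj₁ i→j) ⟨
        μ graph (c i) (c j)                         ≡⟨ mult (c∈V i) (c∈V j) (τ∈X (c∈V i)) (τ∈X (c∈V j)) i∈ j∈ ⟨
        μ coverGraph (τ (c i)) (τ (c j)) * s        ∎))
        where open ≡-Reasoning

    obstruct : (∃[ i ] ∃[ b ] τ (c (inject₁ i)) ∈ U b × τ (c (suc i)) ∈ U b) ⊎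
               (∃[ b ] τ (c zero) ∈ U b × τ (c (fromℕ k′)) ∈ U (flip k′ b)) → Obstruction 𝒞 τ
    -- By computation `predecessor (suc i)` is `inject₁ i`, and `predecessor zero` is the last
    -- index.
    obstruct (inj₁ (i , b , i∈ , j∈)) = edge b (proj₂ (predecessor (suc i))) i∈ j∈
    -- With an even number of changes the last colour equals the first, so the edge closing the
    -- cycle joins equal colours.
    obstruct (inj₂ (b , z∈ , l∈))     = edge b (proj₂ (predecessor {suc k′} zero))
      (subst (λ b → τ (c (fromℕ k′)) ∈ U b) (flip-odd k′ b odd) l∈) z∈

even-C-balanced : ∀ {𝒞} → IsEvenCConfiguration 𝒞 → Balanced 𝒞
even-C-balanced {𝒞} record { k = zero ; k≥4 = () }
even-C-balanced {𝒞} isC@record { k = suc k′ ; inflation = s , _ , C₀ , doubleCover , isInflation } = record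
  { nonempty    = c zero , c∈V zero
  ; degree-sum  = degree-sum
  ; obstruction = λ τ τ∈X → obstruction-if-positive {𝒞} (monochromatic τ∈X)
  }
  where
  open Configuration 𝒞
  open IsEvenCConfiguration isC hiding (k)
  module Cyc = IsMultiCycle cycle
  module Inf = IsInflation isInflation
  module Dbl = IsDoubleCover doubleCover
  k = suc k′

  c∈V : ∀ i → c i ∈ V graph
  c∈V i = Equivalence.from (Cyc.vertices (c i)) (i , refl)

  -- The `2k`-cycle winds twice around `c`; the Boolean says in which of the two rounds the vertex
  -- over `c i` is visited.
  lift : Bool → Fin k → Fin (k + k)
  lift true  i = i ↑ˡ k
  lift false i = k ↑ʳ i

  x∈X : ∀ b i → Dbl.x (lift b i) ∈ X C₀ (c i)
  x∈X true  i = subst (_ ∈_) (sym (Dbl.pair i)) (p⊆p∪q _ (x∈⁅x⁆ _))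
  x∈X false i = subst (_ ∈_) (sym (Dbl.pair i)) (q⊆p∪q ⁅ Dbl.x (i ↑ˡ k) ⁆ _ (x∈⁅x⁆ _))

  x∈V : ∀ b i → Dbl.x (lift b i) ∈ V (H C₀)
  x∈V b i = list⊆V Dbl.isCover (c∈V i) (x∈X b i)

  lift-distinct : ∀ i → Dbl.x (lift true i) ≢ Dbl.x (lift false i)
  lift-distinct i eq = <⇒≢ (≤-trans (toℕ<n i) (m≤m+n k (toℕ i)))
    (trans (sym (toℕ-↑ˡ i k)) (trans (cong toℕ (Dbl.injective eq)) (toℕ-↑ʳ k i)))

  B : Bool → Fin k → Subset m
  B b i = Inf.B (Dbl.x (lift b i))

  list∩U≡ : ∀ i → list (c i) ∩ U ≡ B true i ∪ B false i
  list∩U≡ i = ⊆-antisym to from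
    where
    to : list (c i) ∩ U ⊆ B true i ∪ B false i
    to a∈ with Equivalence.to (Inf.lists (c∈V i) _) a∈
    ... | y , y∈X , a∈B with x∈p∪q⁻ ⁅ Dbl.x (lift true i) ⁆ _ (subst (y ∈_) (Dbl.pair i) y∈X)
    ...   | inj₁ y∈ = p⊆p∪q _ (subst (λ z → _ ∈ Inf.B z) (x∈⁅y⁆⇒x≡y _ y∈) a∈B)
    ...   | inj₂ y∈ = q⊆p∪q (B true i) _ (subst (λ z → _ ∈ Inf.B z) (x∈⁅y⁆⇒x≡y _ y∈) a∈B)
    from : B true i ∪ B false i ⊆ list (c i) ∩ U
    from a∈ with x∈p∪q⁻ (B true i) _ a∈
    ... | inj₁ a∈B = Equivalence.from (Inf.lists (c∈V i) _) (_ , x∈X true i , a∈B)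
    ... | inj₂ a∈B = Equivalence.from (Inf.lists (c∈V i) _) (_ , x∈X false i , a∈B)

  -- The two blocks over `c i` replace distinct vertices of the `2k`-cycle and are therefore
  -- disjoint.
  size : ∀ i → ∣ list (c i) ∩ U ∣ ≡ s * 2
  size i = begin
    ∣ list (c i) ∩ U ∣                        ≡⟨ cong ∣_∣ (list∩U≡ i) ⟩
    ∣ B true i ∪ B false i ∣                  ≡⟨ ∣S∣≡sum (B true i ∪ B false i) ⟩
    sumOver (B true i ∪ B false i) (λ _ → 1)  ≡⟨ sumOver-∪ (B true i) (B false i) _ (λ a∈ a∈′ → contradiction
      (_ , x∈p∩q⁺ (a∈ , a∈′)) (Inf.disjoint (x∈V true i) (x∈V false i) (lift-distinct i))) ⟩
    sumOver (B true i) (λ _ → 1) + sumOver (B false i) (λ _ → 1)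
                                              ≡⟨ cong₂ _+_ (∣S∣≡sum (B true i)) (∣S∣≡sum (B false i)) ⟨
    ∣ B true i ∣ + ∣ B false i ∣              ≡⟨ cong₂ _+_ (Inf.size (x∈V true i)) (Inf.size (x∈V false i)) ⟩
    s + s                                     ≡⟨ cong (s +_) (+-identityʳ s) ⟨
    2 * s                                     ≡⟨ *-comm 2 s ⟩
    s * 2                                     ∎
    where open ≡-Reasoning

  degree-sum : ∀ {v} → v ∈ V graph → sumOver (list v) f ≡ deg graph v
  degree-sum v∈V with Equivalence.to (Cyc.vertices _) v∈V
  ... | i , refl = begin
    sumOver (list (c i)) f      ≡⟨ sumOver-support f (p∩q⊆p (list (c i)) U) (λ x∈X x∉ →
      f-outside v∈V x∈X (λ x∈U → x∉ (x∈p∩q⁺ (x∈X , x∈U)))) ⟩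
    sumOver (list (c i) ∩ U) f  ≡⟨ sumOver-quotients (list (c i) ∩ U) f (2 * t) nonzero
      (λ x∈ → let x∈X , x∈U = x∈p∩q⁻ (list (c i)) U x∈ in f-inside v∈V x∈X x∈U) ⟩
    2 * t                       ≡⟨ cycle-degree (≤-trans (n≤1+n 3) k≥4) cycle v∈V ⟨
    deg graph (c i)             ∎
    where
    open ≡-Reasoning
    nonzero : 1 ≤ ∣ list (c i) ∩ U ∣
    nonzero = ≤-trans (≤-trans Inf.s≥1 (m≤m*n s 2)) (≤-reflexive (sym (size i)))

  lift-successor : ∀ b i → Successor (lift b (inject₁ i)) (lift b (suc i))
  lift-successor true  i = successor-suc {j = suc i ↑ˡ k} (cong suc (trans (toℕ-↑ˡ (inject₁ i) k)
    (trans (toℕ-inject₁ i) (sym (toℕ-↑ˡ i k)))))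
  lift-successor false i = successor-suc {j = k ↑ʳ suc i} (begin
    suc (toℕ (k ↑ʳ inject₁ i))  ≡⟨ cong suc (toℕ-↑ʳ k (inject₁ i)) ⟩
    suc (k + toℕ (inject₁ i))   ≡⟨ cong (λ z → suc (k + z)) (toℕ-inject₁ i) ⟩
    suc (k + toℕ i)             ≡⟨ +-suc k (toℕ i) ⟨
    k + suc (toℕ i)             ≡⟨ toℕ-↑ʳ k (suc i) ⟨
    toℕ (k ↑ʳ suc i)            ∎)
    where open ≡-Reasoning

  -- The 2k-cycle passes from the last vertex of one layer to the first of the other.
  lift-wrap : ∀ b → Successor (lift (not b) (fromℕ k′)) (lift b zero)
  lift-wrap true  = successor-wrap {j = zero ↑ˡ k} (begin
    suc (toℕ (k ↑ʳ fromℕ k′))   ≡⟨ cong suc (toℕ-↑ʳ k (fromℕ k′)) ⟩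
    suc (k + toℕ (fromℕ k′))    ≡⟨ cong (λ z → suc (k + z)) (toℕ-fromℕ k′) ⟩
    suc (k + k′)                ≡⟨ +-suc k k′ ⟨
    k + k                       ∎) refl
    where open ≡-Reasoning
  lift-wrap false = successor-suc {j = k ↑ʳ zero} (begin
    suc (toℕ (fromℕ k′ ↑ˡ k))   ≡⟨ cong suc (trans (toℕ-↑ˡ (fromℕ k′) k) (toℕ-fromℕ k′)) ⟩
    k                           ≡⟨ +-identityʳ k ⟨
    k + 0                       ≡⟨ toℕ-↑ʳ k zero ⟨
    toℕ (k ↑ʳ zero)             ∎)
    where open ≡-Reasoning

  monochromatic : ∀ {τ} → IsSelector graph cover τ → (∀ {v} → v ∈ V graph → f (τ v) ≢ 0) → Obstruction 𝒞 τ
  monochromatic {τ} τ∈X f≢0 = obstruct (repeat-or-alternate k′ layer)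
    where
    τ∈U : ∀ i → τ (c i) ∈ U
    τ∈U i with τ (c i) ∈? U
    ... | yes ∈U = ∈U
    ... | no  ∉U = contradiction (f-outside (c∈V i) (τ∈X (c∈V i)) ∉U) (f≢0 (c∈V i))

    layer : ∀ i → ∃[ b ] τ (c i) ∈ B b i
    layer i with x∈p∪q⁻ (B true i) (B false i) (subst (_ ∈_) (list∩U≡ i) (x∈p∩q⁺ (τ∈X (c∈V i) , τ∈U i)))
    ... | inj₁ ∈B = true , ∈B
    ... | inj₂ ∈B = false , ∈B

    edge : ∀ {i j} b b′ → Successor (lift b i) (lift b′ j) → τ (c i) ∈ B b i → τ (c j) ∈ B b′ j → Obstruction 𝒞 τ
    edge {i} {j} b b′ i→j i∈ j∈ = edge-obstruction {𝒞} (c∈V i) (c∈V j) (f≤μ i) (f≤μ j)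
      where
      open ≡-Reasoning
      -- The prescribed value is `2t` divided by a list size of `2s`. The factor two cancels, so a
      -- single edge of the inflated `2k`-cycle already matches `f` at both of its ends.
      f*s≡t : ∀ l → f (τ (c l)) * s ≡ t
      f*s≡t l = *-cancelʳ-≡ _ _ 2 (begin
        f (τ (c l)) * s * 2               ≡⟨ *-assoc (f (τ (c l))) s 2 ⟩
        f (τ (c l)) * (s * 2)             ≡⟨ cong (f (τ (c l)) *_) (size l) ⟨
        f (τ (c l)) * ∣ list (c l) ∩ U ∣  ≡⟨ f-inside (c∈V l) (τ∈X (c∈V l)) (τ∈U l) ⟩
        2 * t                             ≡⟨ *-comm 2 t ⟩
        t * 2                             ∎)
      μ*s≡t : μ coverGraph (τ (c i)) (τ (c j)) * s ≡ t
      μ*s≡t = begin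
        μ coverGraph (τ (c i)) (τ (c j)) * s              ≡⟨ cong (_* s) (induced-μ coverGraph (τ∈U i) (τ∈U j)) ⟨
        μ (induced coverGraph U) (τ (c i)) (τ (c j)) * s  ≡⟨ inflation-μ isInflation (x∈V b i) (x∈V b′ j) i∈ j∈ ⟩
        μ (H C₀) (Dbl.x (lift b i)) (Dbl.x (lift b′ j))   ≡⟨ Dbl.adjacent _ _ (inj₁ i→j) ⟩
        t                                                 ∎
      f≤μ : ∀ l → f (τ (c l)) ≤ μ coverGraph (τ (c i)) (τ (c j))
      f≤μ l = *-cancelʳ-≤ _ _ s {{>-nonZero Inf.s≥1}} (≤-reflexive (trans (f*s≡t l) (sym μ*s≡t)))

    obstruct : (∃[ i ] ∃[ b ] τ (c (inject₁ i)) ∈ B b (inject₁ i) × τ (c (suc i)) ∈ B b (suc i)) ⊎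
               (∃[ b ] τ (c zero) ∈ B b zero × τ (c (fromℕ k′)) ∈ B (flip k′ b) (fromℕ k′)) → Obstruction 𝒞 τ
    obstruct (inj₁ (i , b , i∈ , j∈)) = edge b b (lift-successor b i) i∈ j∈
    -- An even number of vertices means an odd number of changes, so the last vertex lies in layer
    -- `not b`. The `2k`-cycle switches layers exactly at the wrap, which makes the two colours
    -- consecutive on it.
    obstruct (inj₂ (b , z∈ , l∈))     = edge (not b) b (lift-wrap b)
      (subst (λ b → τ (c (fromℕ k′)) ∈ B b (fromℕ k′)) (flip-even k′ b even) l∈) z∈

-- Induction over the recursive definition of constructible configurations.

constructible⇒balanced : ∀ {𝒞} → Constructible 𝒞 → Balanced 𝒞
constructible⇒balanced (K1 _ isM)         = M-balanced isM
constructible⇒balanced (K2 _ isK)         = K-balanced isK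
constructible⇒balanced (K3 _ isC)         = odd-C-balanced isC
constructible⇒balanced (K4 _ isC)         = even-C-balanced isC
constructible⇒balanced (K5 _ c¹ c² merge) =
  merge-balanced merge (constructible⇒balanced c¹) (constructible⇒balanced c²)

proposition11 : (𝒞 : Configuration) → Constructible 𝒞 →
    (∀ v → v ∈ V (Configuration.graph 𝒞) →
    sumOver (Configuration.list 𝒞 v) (Configuration.f 𝒞) ≡ deg (Configuration.graph 𝒞) v)
    × Uncolorable 𝒞
proposition11 𝒞 constructible =
  (λ v → Balanced.degree-sum balanced) , balanced⇒uncolorable balanced
  where
  balanced : Balanced 𝒞
  balanced = constructible⇒balanced constructible
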